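{- The integrality gap of the semidefinite program $\mathrm{SDP}_2$ (the symmetry-reduced QAP relaxation of the traveling salesman problem defined in the context) is at least $2$; that is, $$\sup_{D\in\mathcal{D}} \frac{\mathrm{OPT}_{\mathrm{TSP}}(D)}{\mathrm{OPT}_{\mathrm{SDP}_2}(D)}\ \ge\ 2 .$$
   Context: TSP: an instance on $N$ vertices is a symmetric matrix $D=(d_{ij})\in\mathbb{R}^{N\times N}$ with $d_{ij}\ge 0$, $d_{ii}=0$ and $d_{ij}\le d_{ik}+d_{kj}$ for all $i,j,k$ (distinct vertices may be at distance $0$). $\mathcal{D}$ is the set of all such matrices, over all $N\ge 3$. $\mathrm{OPT}_{\mathrm{TSP}}(D)$ is the minimum total cost of a Hamiltonian cycle in the complete graph $K_N$ with edge costs $d_{ij}$. Notation: $[m]=\{1,\dots,m\}$; $I_m$, $J_m$ are the $m\times m$ identity and all-ones matrices; $E^{(m)}_{jj}$ is the $m\times m$ matrix with a single $1$ in position $(j,j)$; $\mathbb{S}^{m\times m}$ is the set of real symmetric $m\times m$ matrices; $M[S,T]$ is the submatrix of $M$ with rows in $S$ and columns in $T$, and $M[S]=M[S,S]$; $\mathrm{Diag}(x)$ is the diagonal matrix with diagonal $x$; $\mathrm{vec}(M)$ stacks the columns of $M$; $\otimes$ is the Kronecker product; $Y\ge 0$ is entrywise nonnegativity and $Y\succeq 0$ is positive semidefiniteness. $C^{(N)}_1$ is the adjacency matrix of the $N$-cycle on $[N]$ with edges $\{i,i+1\}$ and $\{N,1\}$. $\mathrm{SDP}_2$: for an $N$-vertex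 instance $D$, put $n=N-1$, fix $r,s\in[n+1]$, and let $\alpha=[n+1]\setminus\{r\}$, $\beta=[n+1]\setminus\{s\}$, $\bar c=\mathrm{vec}\big(C^{(n+1)}_1[\alpha,\{r\}]\,D[\{s\},\beta]\big)\in\mathbb{R}^{n^2}$. Then $\mathrm{OPT}_{\mathrm{SDP}_2}(D)$ is the minimum of $$\mathrm{trace}\Big(\big(D[\beta]\otimes \tfrac12 C^{(n+1)}_1[\alpha]+\mathrm{Diag}(\bar c)\big)Y\Big)$$ over $Y\in\mathbb{S}^{n^2\times n^2}$ with $Y\ge 0$, $Y\succeq 0$ and (i) $\mathrm{trace}((I_n\otimes E^{(n)}_{jj})Y)=1$ for $j=1,\dots,n$; (ii) $\mathrm{trace}((E^{(n)}_{jj}\otimes I_n)Y)=1$ for $j=1,\dots,n$; (iii) $\mathrm{trace}\big((I_n\otimes(J_n-I_n)+(J_n-I_n)\otimes I_n)Y\big)=0$; (iv) $\mathrm{trace}((J_n\otimes J_n)Y)=n^2$. The choice of $r,s$ for each $N$ is arbitrary but fixed (one may take $r=s=1$). In the supremum, instances with $\mathrm{OPT}_{\mathrm{TSP}}(D)=0$ are disregarded, and a ratio with positive numerator and zero denominator is read as $+\infty$. -}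

module Defs where

open import Algebra.Bundles.Raw using (RawMonoid)
import Algebra.Definitions.RawMonoid as RawMonoidDefs
open import Data.Bool using (Bool; if_then_else_; _∨_)
open import Data.Fin using (Fin; toℕ; punchIn; quotient; remainder)
open import Data.Fin.Properties using (_≟_)
open import Data.Fin.Permutation using (Permutation′; _⟨$⟩ʳ_)
open import Data.Integer using (+_)
open import Data.Nat as ℕ using (ℕ; suc)
import Data.Nat.Properties as ℕ
open import Data.Nat.DivMod using (_mod_)
open import Data.Product using (Σ-syntax; ∃-syntax; _×_; _,_; proj₁; proj₂)
open import Data.Rational as ℚ using (ℚ; 0ℚ; 1ℚ; ½; ∣_∣)
import Data.Rational.Properties as ℚ
open import Data.Rational.Solver using (module +-*-Solver)
open import Data.Vec.Functional using (Vector)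
open import Function using (const; _⇔_; mk⇔)
open import Level using (0ℓ)
open import Relation.Binary.PropositionalEquality using (_≡_; refl; sym; trans; cong)
open import Relation.Nullary.Decidable using (⌊_⌋)

------------------------------------------------------------------------
-- Real numbers: Cauchy sequences of rationals, with a setoid equality

IsCauchy : (ℕ → ℚ) → Set
IsCauchy x = ∀ ε → 0ℚ ℚ.< ε →
  ∃[ K ] (∀ m n → K ℕ.≤ m → K ℕ.≤ n → ∣ x m ℚ.- x n ∣ ℚ.≤ ε)

record ℝ : Set where
  no-eta-equality
  constructor mkℝ
  field
    seq      : ℕ → ℚ
    isCauchy : IsCauchy seq
open ℝ public

infix 4 _≈_ _≤_ _<_

record _≤_ (x y : ℝ) : Set where
  constructor mk≤
  field
    eventually≤ : ∀ ε → 0ℚ ℚ.< ε → ∃[ K ] (∀ n → K ℕ.≤ n → seq x n ℚ.≤ seq y n ℚ.+ ε)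

record _<_ (x y : ℝ) : Set where
  constructor mk<
  field
    gap         : ℚ
    0<gap       : 0ℚ ℚ.< gap
    eventually< : ∃[ K ] (∀ n → K ℕ.≤ n → seq x n ℚ.+ gap ℚ.≤ seq y n)

record _≈_ (x y : ℝ) : Set where
  constructor mk≈
  field
    ≈⇒≤ : x ≤ y
    ≈⇒≥ : y ≤ x

private
  open ℚ.≤-Reasoning
  open +-*-Solver

  abstract
    sum-sub : ∀ a b c d → (a ℚ.+ b) ℚ.- (c ℚ.+ d) ≡ (a ℚ.- c) ℚ.+ (b ℚ.- d)
    sum-sub = solve 4 (λ a b c d → (a :+ b) :- (c :+ d) := (a :- c) :+ (b :- d)) refl

    neg-sub : ∀ a b → ℚ.- a ℚ.- ℚ.- b ≡ ℚ.- (a ℚ.- b)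
    neg-sub = solve 2 (λ a b → :- a :- :- b := :- (a :- b)) refl

    sub-add : ∀ a b → a ≡ (a ℚ.- b) ℚ.+ b
    sub-add = solve 2 (λ a b → a := (a :- b) :+ b) refl

    mul-sub : ∀ a b c d → a ℚ.* b ℚ.- c ℚ.* d ≡ a ℚ.* (b ℚ.- d) ℚ.+ (a ℚ.- c) ℚ.* d
    mul-sub = solve 4 (λ a b c d → a :* b :- c :* d := a :* (b :- d) :+ (a :- c) :* d) refl

    collect : ∀ a b e i → a ℚ.* (e ℚ.* i) ℚ.+ (e ℚ.* i) ℚ.* b ≡ e ℚ.* (i ℚ.* (a ℚ.+ b))
    collect = solve 4 (λ a b e i → a :* (e :* i) :+ (e :* i) :* b := e :* (i :* (a :+ b))) refl

    add-sub : ∀ a b → (a ℚ.+ b) ℚ.- b ≡ a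
    add-sub = solve 2 (λ a b → (a :+ b) :- b := a) refl

    halve : ∀ ε → 0ℚ ℚ.< ε → ∃[ h ] (0ℚ ℚ.< h × h ℚ.+ h ≡ ε)
    halve ε 0<ε = ½ ℚ.* ε
                , ℚ.positive⁻¹ (½ ℚ.* ε) {{ℚ.pos*pos⇒pos ½ ε {{ℚ.positive 0<ε}}}}
                , trans (sym (ℚ.*-distribʳ-+ ε ½ ½)) (ℚ.*-identityˡ ε)

    const-isCauchy : ∀ q → IsCauchy (const q)
    const-isCauchy q ε 0<ε = 0 , λ _ _ _ _ → begin
      ∣ q ℚ.- q ∣  ≡⟨ cong ∣_∣ (ℚ.+-inverseʳ q) ⟩
      0ℚ           <⟨ 0<ε ⟩
      ε            ∎

    +-isCauchy : ∀ x y → IsCauchy x → IsCauchy y → IsCauchy (λ n → x n ℚ.+ y n)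
    +-isCauchy x y cx cy ε 0<ε with halve ε 0<ε
    ... | h , 0<h , h+h≡ε with cx h 0<h | cy h 0<h
    ... | K , hx | L , hy = K ℕ.⊔ L , λ m n Km Kn → begin
      ∣ (x m ℚ.+ y m) ℚ.- (x n ℚ.+ y n) ∣
        ≡⟨ cong ∣_∣ (sum-sub (x m) (y m) (x n) (y n)) ⟩
      ∣ (x m ℚ.- x n) ℚ.+ (y m ℚ.- y n) ∣
        ≤⟨ ℚ.∣p+q∣≤∣p∣+∣q∣ (x m ℚ.- x n) (y m ℚ.- y n) ⟩
      ∣ x m ℚ.- x n ∣ ℚ.+ ∣ y m ℚ.- y n ∣
        ≤⟨ ℚ.+-mono-≤ (hx m n (ℕ.m⊔n≤o⇒m≤o K L Km) (ℕ.m⊔n≤o⇒m≤o K L Kn))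
                      (hy m n (ℕ.m⊔n≤o⇒n≤o K L Km) (ℕ.m⊔n≤o⇒n≤o K L Kn)) ⟩
      h ℚ.+ h
        ≡⟨ h+h≡ε ⟩
      ε ∎

    neg-isCauchy : ∀ x → IsCauchy x → IsCauchy (λ n → ℚ.- x n)
    neg-isCauchy x cx ε 0<ε with cx ε 0<ε
    ... | K , hx = K , λ m n Km Kn → begin
      ∣ ℚ.- x m ℚ.- ℚ.- x n ∣  ≡⟨ cong ∣_∣ (neg-sub (x m) (x n)) ⟩
      ∣ ℚ.- (x m ℚ.- x n) ∣    ≡⟨ ℚ.∣-p∣≡∣p∣ (x m ℚ.- x n) ⟩
      ∣ x m ℚ.- x n ∣          ≤⟨ hx m n Km Kn ⟩
      ε ∎

    bounded : ∀ x → IsCauchy x →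
              ∃[ B ] (0ℚ ℚ.< B × ∃[ K ] (∀ n → K ℕ.≤ n → ∣ x n ∣ ℚ.≤ B))
    bounded x cx with cx 1ℚ (ℚ.positive⁻¹ 1ℚ)
    ... | K , hx = 1ℚ ℚ.+ ∣ x K ∣
                 , ℚ.<-≤-trans (ℚ.positive⁻¹ 1ℚ) (begin
                     1ℚ                 ≡⟨ ℚ.+-identityʳ 1ℚ ⟨
                     1ℚ ℚ.+ 0ℚ          ≤⟨ ℚ.+-monoʳ-≤ 1ℚ (ℚ.0≤∣p∣ (x K)) ⟩
                     1ℚ ℚ.+ ∣ x K ∣     ∎)
                 , K , λ n Kn → begin
      ∣ x n ∣                        ≡⟨ cong ∣_∣ (sub-add (x n) (x K)) ⟩
      ∣ (x n ℚ.- x K) ℚ.+ x K ∣      ≤⟨ ℚ.∣p+q∣≤∣p∣+∣q∣ (x n ℚ.- x K) (x K) ⟩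
      ∣ x n ℚ.- x K ∣ ℚ.+ ∣ x K ∣    ≤⟨ ℚ.+-monoˡ-≤ ∣ x K ∣ (hx n K Kn ℕ.≤-refl) ⟩
      1ℚ ℚ.+ ∣ x K ∣                 ∎

    *-mono-∣∣ : ∀ {p q a b} → ∣ p ∣ ℚ.≤ a → ∣ q ∣ ℚ.≤ b → 0ℚ ℚ.< a →
                ∣ p ℚ.* q ∣ ℚ.≤ a ℚ.* b
    *-mono-∣∣ {p} {q} {a} {b} p≤a q≤b 0<a = begin
      ∣ p ℚ.* q ∣        ≡⟨ ℚ.∣p*q∣≡∣p∣*∣q∣ p q ⟩
      ∣ p ∣ ℚ.* ∣ q ∣    ≤⟨ ℚ.*-monoʳ-≤-nonNeg ∣ q ∣ {{ℚ.∣-∣-nonNeg q}} p≤a ⟩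
      a ℚ.* ∣ q ∣        ≤⟨ ℚ.*-monoˡ-≤-nonNeg a {{ℚ.nonNegative (ℚ.<⇒≤ 0<a)}} q≤b ⟩
      a ℚ.* b            ∎

    share : ∀ A B ε → 0ℚ ℚ.< A → 0ℚ ℚ.< B → 0ℚ ℚ.< ε →
            ∃[ δ ] (0ℚ ℚ.< δ × A ℚ.* δ ℚ.+ δ ℚ.* B ≡ ε)
    share A B ε 0<A 0<B 0<ε = ε ℚ.* i
      , ℚ.positive⁻¹ (ε ℚ.* i)
          {{ℚ.pos*pos⇒pos ε {{ℚ.positive 0<ε}} i {{ℚ.1/pos⇒pos (A ℚ.+ B)}}}}
      , trans (collect A B ε i)
          (trans (cong (ε ℚ.*_) (ℚ.*-inverseˡ (A ℚ.+ B))) (ℚ.*-identityʳ ε))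
      where
      instance
        pos : ℚ.Positive (A ℚ.+ B)
        pos = ℚ.pos+pos⇒pos A {{ℚ.positive 0<A}} B {{ℚ.positive 0<B}}
        nonZero : ℚ.NonZero (A ℚ.+ B)
        nonZero = ℚ.pos⇒nonZero (A ℚ.+ B)
      i : ℚ
      i = ℚ.1/ (A ℚ.+ B)

    *-close : ∀ {a b c d A B δ ε} → 0ℚ ℚ.< A → 0ℚ ℚ.< δ → A ℚ.* δ ℚ.+ δ ℚ.* B ≡ ε →
              ∣ a ∣ ℚ.≤ A → ∣ d ∣ ℚ.≤ B → ∣ a ℚ.- c ∣ ℚ.≤ δ → ∣ b ℚ.- d ∣ ℚ.≤ δ →
              ∣ a ℚ.* b ℚ.- c ℚ.* d ∣ ℚ.≤ ε
    *-close {a} {b} {c} {d} {A} {B} {δ} {ε} 0<A 0<δ eq a≤A d≤B a-c b-d = begin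
      ∣ a ℚ.* b ℚ.- c ℚ.* d ∣
        ≡⟨ cong ∣_∣ (mul-sub a b c d) ⟩
      ∣ a ℚ.* (b ℚ.- d) ℚ.+ (a ℚ.- c) ℚ.* d ∣
        ≤⟨ ℚ.∣p+q∣≤∣p∣+∣q∣ (a ℚ.* (b ℚ.- d)) ((a ℚ.- c) ℚ.* d) ⟩
      ∣ a ℚ.* (b ℚ.- d) ∣ ℚ.+ ∣ (a ℚ.- c) ℚ.* d ∣
        ≤⟨ ℚ.+-mono-≤ (*-mono-∣∣ {a} {b ℚ.- d} a≤A b-d 0<A)
                      (*-mono-∣∣ {a ℚ.- c} {d} a-c d≤B 0<δ) ⟩
      A ℚ.* δ ℚ.+ δ ℚ.* B
        ≡⟨ eq ⟩
      ε ∎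

    *-isCauchy : ∀ x y → IsCauchy x → IsCauchy y → IsCauchy (λ n → x n ℚ.* y n)
    *-isCauchy x y cx cy ε 0<ε =
      let A , 0<A , K₁ , bx = bounded x cx
          B , 0<B , K₂ , by = bounded y cy
          δ , 0<δ , eq      = share A B ε 0<A 0<B 0<ε
          K₃ , hx           = cx δ 0<δ
          K₄ , hy           = cy δ 0<δ
          K = (K₁ ℕ.⊔ K₂) ℕ.⊔ (K₃ ℕ.⊔ K₄)
          l = λ o (h : K ℕ.≤ o) → ℕ.m⊔n≤o⇒m≤o (K₁ ℕ.⊔ K₂) (K₃ ℕ.⊔ K₄) h
          r = λ o (h : K ℕ.≤ o) → ℕ.m⊔n≤o⇒n≤o (K₁ ℕ.⊔ K₂) (K₃ ℕ.⊔ K₄) h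
      in K , λ m n Km Kn →
         *-close {x m} {y m} {x n} {y n} {A} {B} {δ} {ε} 0<A 0<δ eq
           (bx m (ℕ.m⊔n≤o⇒m≤o K₁ K₂ (l m Km)))
           (by n (ℕ.m⊔n≤o⇒n≤o K₁ K₂ (l n Kn)))
           (hx m n (ℕ.m⊔n≤o⇒m≤o K₃ K₄ (r m Km)) (ℕ.m⊔n≤o⇒m≤o K₃ K₄ (r n Kn)))
           (hy m n (ℕ.m⊔n≤o⇒n≤o K₃ K₄ (r m Km)) (ℕ.m⊔n≤o⇒n≤o K₃ K₄ (r n Kn)))

infixl 6 _+_ _-_
infixl 7 _*_
infix  8 -_

fromℚ : ℚ → ℝ
fromℚ q = mkℝ (const q) (const-isCauchy q)

fromℕ : ℕ → ℝ
fromℕ n = fromℚ (+ n ℚ./ 1)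

0ℝ 1ℝ 2ℝ ½ℝ : ℝ
0ℝ = fromℕ 0
1ℝ = fromℕ 1
2ℝ = fromℕ 2
½ℝ = fromℚ ½

_+_ : ℝ → ℝ → ℝ
x + y = mkℝ (λ n → seq x n ℚ.+ seq y n) (+-isCauchy (seq x) (seq y) (isCauchy x) (isCauchy y))

-_ : ℝ → ℝ
- x = mkℝ (λ n → ℚ.- seq x n) (neg-isCauchy (seq x) (isCauchy x))

_-_ : ℝ → ℝ → ℝ
x - y = x + (- y)

_*_ : ℝ → ℝ → ℝ
x * y = mkℝ (λ n → seq x n ℚ.* seq y n) (*-isCauchy (seq x) (seq y) (isCauchy x) (isCauchy y))

+-rawMonoid : RawMonoid 0ℓ 0ℓ
+-rawMonoid = record { Carrier = ℝ ; _≈_ = _≈_ ; _∙_ = _+_ ; ε = 0ℝ }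

open RawMonoidDefs +-rawMonoid public using (sum)

------------------------------------------------------------------------
-- Optimal values

IsMinimum : {I : Set} → (I → ℝ) → ℝ → Set
IsMinimum {I} f v = (∃[ i ] f i ≈ v) × (∀ i → v ≤ f i)

-- An extended real v, given by the reals q < v and the reals q > v. The two
-- halves need not be located, so every infimum exists constructively.
record Cut : Set₁ where
  field
    Below : ℝ → Set
    Above : ℝ → Set
open Cut public

inf : {I : Set} → (I → ℝ) → Cut
inf f .Below q = ∃[ r ] (q < r × (∀ i → r ≤ f i))
inf f .Above q = ∃[ i ] f i < q

private
  K-⊔ : ∀ {P Q R : ℕ → Set} → (∀ n → P n → Q n → R n) →
        ∃[ K ] (∀ n → K ℕ.≤ n → P n) → ∃[ K ] (∀ n → K ℕ.≤ n → Q n) →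
        ∃[ K ] (∀ n → K ℕ.≤ n → R n)
  K-⊔ f (K , p) (L , q) = K ℕ.⊔ L , λ n h →
    f n (p n (ℕ.m⊔n≤o⇒m≤o K L h)) (q n (ℕ.m⊔n≤o⇒n≤o K L h))

<-≤-trans : ∀ {x y z} → x < y → y ≤ z → x < z
<-≤-trans {x} {y} {z} (mk< ε 0<ε x<y) (mk≤ y≤z) with halve ε 0<ε
... | h , 0<h , h+h≡ε = mk< h 0<h (K-⊔ (λ n p q → begin
    seq x n ℚ.+ h                        ≡⟨ add-sub (seq x n ℚ.+ h) h ⟨
    ((seq x n ℚ.+ h) ℚ.+ h) ℚ.- h        ≡⟨ cong (ℚ._- h) (ℚ.+-assoc (seq x n) h h) ⟩
    (seq x n ℚ.+ (h ℚ.+ h)) ℚ.- h        ≡⟨ cong (λ e → (seq x n ℚ.+ e) ℚ.- h) h+h≡ε ⟩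
    (seq x n ℚ.+ ε) ℚ.- h                ≤⟨ ℚ.+-monoˡ-≤ (ℚ.- h) (ℚ.≤-trans p q) ⟩
    (seq z n ℚ.+ h) ℚ.- h                ≡⟨ add-sub (seq z n) h ⟩
    seq z n                              ∎) x<y (y≤z h 0<h))

≤-<-trans : ∀ {x y z} → x ≤ y → y < z → x < z
≤-<-trans {x} {y} {z} (mk≤ x≤y) (mk< ε 0<ε y<z) with halve ε 0<ε
... | h , 0<h , h+h≡ε = mk< h 0<h (K-⊔ (λ n p q → begin
    seq x n ℚ.+ h                        ≤⟨ ℚ.+-monoˡ-≤ h p ⟩
    (seq y n ℚ.+ h) ℚ.+ h                ≡⟨ ℚ.+-assoc (seq y n) h h ⟩
    seq y n ℚ.+ (h ℚ.+ h)                ≡⟨ cong (seq y n ℚ.+_) h+h≡ε ⟩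
    seq y n ℚ.+ ε                        ≤⟨ q ⟩
    seq z n                              ∎) (x≤y h 0<h) y<z)

-- An attained minimum and the infimum are the same cut.

inf-below : ∀ {I : Set} {f : I → ℝ} {v} → IsMinimum f v → ∀ q → Below (inf f) q ⇔ q < v
inf-below {v = v} ((i , mk≈ fi≤v _) , v≤f) q = mk⇔
  (λ { (r , q<r , r≤f) → <-≤-trans (<-≤-trans q<r (r≤f i)) fi≤v })
  (λ q<v → v , q<v , v≤f)

inf-above : ∀ {I : Set} {f : I → ℝ} {v} → IsMinimum f v → ∀ q → Above (inf f) q ⇔ v < q
inf-above ((i , mk≈ fi≤v _) , v≤f) q = mk⇔
  (λ { (j , fj<q) → ≤-<-trans (v≤f j) fj<q })
  (λ v<q → i , ≤-<-trans fi≤v v<q)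

-- A supremum in (−∞, +∞] is determined by the reals strictly below it, so
-- such values are represented by predicates on ℝ.
LowerReal : Set₁
LowerReal = ℝ → Set

infixl 7 _÷_
infix 4 _≤ᴸ_

-- The reals c with c < A / B, for A > 0 and B ≥ 0: c·y < A for some y > B.
-- In particular every c qualifies if B = 0.
_÷_ : Cut → Cut → LowerReal
(A ÷ B) c = ∃[ y ] (Above B y × Below A (c * y))

⨆ : {I : Set} → (I → LowerReal) → LowerReal
(⨆ L) c = ∃[ i ] L i c

_≤ᴸ_ : ℝ → LowerReal → Set
q ≤ᴸ L = ∀ c → c < q → L c

------------------------------------------------------------------------
-- Matrices

Matrix : ℕ → ℕ → Set
Matrix m n = Fin m → Fin n → ℝ

𝟙 : Bool → ℝ
𝟙 b = if b then 1ℝ else 0ℝ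

I J : ∀ m → Matrix m m
I m i j = 𝟙 ⌊ i ≟ j ⌋
J m i j = 1ℝ

E : ∀ m → Fin m → Matrix m m
E m k i j = 𝟙 ⌊ i ≟ k ⌋ * 𝟙 ⌊ j ≟ k ⌋

infixl 6 _⊕_ _⊖_
infixl 7 _⊡_ _⊗_
infixr 8 _·_

_⊕_ _⊖_ : ∀ {m n} → Matrix m n → Matrix m n → Matrix m n
(A ⊕ B) i j = A i j + B i j
(A ⊖ B) i j = A i j - B i j

_·_ : ∀ {m n} → ℝ → Matrix m n → Matrix m n
(c · A) i j = c * A i j

_⊡_ : ∀ {l m n} → Matrix l m → Matrix m n → Matrix l n
(A ⊡ B) i k = sum (λ j → A i j * B j k)

trace : ∀ {m} → Matrix m m → ℝ
trace A = sum (λ i → A i i)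

-- Index k of Fin (m * p) is the pair (quotient, remainder) of k by p, i.e. the
-- left factor indexes the blocks.
_⊗_ : ∀ {m n p q} → Matrix m n → Matrix p q → Matrix (m ℕ.* p) (n ℕ.* q)
_⊗_ {m} {n} {p} {q} A B k l =
  A (quotient p k) (quotient q l) * B (remainder {m} p k) (remainder {n} q l)

-- Column stacking: the column index selects the block, as for ⊗.
vec : ∀ {m n} → Matrix m n → Vector ℝ (n ℕ.* m)
vec {m} {n} A k = A (remainder {n} m k) (quotient m k)

Diag : ∀ {m} → Vector ℝ m → Matrix m m
Diag x i j = x i * I _ i j

-- A set S of indices is given by its increasing enumeration.
_[_,_] : ∀ {m n p q} → Matrix m n → (Fin p → Fin m) → (Fin q → Fin n) → Matrix p q
(A [ S , T ]) i j = A (S i) (T j)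

∖_ : ∀ {n} → Fin (suc n) → Fin n → Fin (suc n)
∖ r = punchIn r

｛_｝ : ∀ {m} → Fin m → Fin 1 → Fin m
｛ r ｝ = const r

record PSD {m} (A : Matrix m m) : Set where
  field
    symmetric : ∀ i j → A i j ≈ A j i
    form≥0    : ∀ (x : Vector ℝ m) → 0ℝ ≤ sum (λ i → sum (λ j → x i * A i j * x j))

------------------------------------------------------------------------
-- Traveling salesman problem

record IsTSPInstance {N} (D : Matrix N N) : Set where
  field
    symmetric : ∀ i j → D i j ≈ D j i
    nonneg    : ∀ i j → 0ℝ ≤ D i j
    diagonal  : ∀ i → D i i ≈ 0ℝ
    triangle  : ∀ i j k → D i j ≤ D i k + D k j

next : ∀ {n} → Fin (suc n) → Fin (suc n)
next {n} i = suc (toℕ i) mod suc n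

-- A Hamiltonian cycle of K_N is given by listing its vertices in cyclic order.
tourCost : ∀ {n} → Matrix (suc n) (suc n) → Permutation′ (suc n) → ℝ
tourCost D σ = sum (λ i → D (σ ⟨$⟩ʳ i) (σ ⟨$⟩ʳ next i))

OPT-TSP : ∀ {n} → Matrix (suc n) (suc n) → Cut
OPT-TSP D = inf (tourCost D)

------------------------------------------------------------------------
-- The semidefinite program, on n = N ∸ 1

-- Adjacency matrix of the cycle on suc n vertices, when suc n ≥ 3.
C₁ : ∀ n → Matrix (suc n) (suc n)
C₁ n i j = 𝟙 (⌊ j ≟ next i ⌋ ∨ ⌊ i ≟ next j ⌋)

record Feasible (n : ℕ) (Y : Matrix (n ℕ.* n) (n ℕ.* n)) : Set where
  field
    psd    : PSD Y
    nonneg : ∀ i j → 0ℝ ≤ Y i j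
    cond₁  : ∀ j → trace ((I n ⊗ E n j) ⊡ Y) ≈ 1ℝ
    cond₂  : ∀ j → trace ((E n j ⊗ I n) ⊡ Y) ≈ 1ℝ
    cond₃  : trace ((I n ⊗ (J n ⊖ I n) ⊕ (J n ⊖ I n) ⊗ I n) ⊡ Y) ≈ 0ℝ
    cond₄  : trace ((J n ⊗ J n) ⊡ Y) ≈ fromℕ (n ℕ.* n)

module _ {n : ℕ} (r s : Fin (suc n)) (D : Matrix (suc n) (suc n)) where
  private
    α β : Fin n → Fin (suc n)
    α = ∖ r
    β = ∖ s

  c̄ : Vector ℝ (n ℕ.* n)
  c̄ = vec {n} {n} ((C₁ n [ α , ｛ r ｝ ]) ⊡ (D [ ｛ s ｝ , β ]))

  SDP₂-cost : Matrix (n ℕ.* n) (n ℕ.* n) → ℝ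
  SDP₂-cost Y = trace (((D [ β , β ]) ⊗ (½ℝ · (C₁ n [ α , α ])) ⊕ Diag c̄) ⊡ Y)

  OPT-SDP₂ : Cut
  OPT-SDP₂ = inf {I = Σ[ Y ∈ Matrix (n ℕ.* n) (n ℕ.* n) ] Feasible n Y} (λ Y → SDP₂-cost (proj₁ Y))

------------------------------------------------------------------------
-- Integrality gap

record Instance : Set where
  field
    n          : ℕ
    N≥3        : 3 ℕ.≤ suc n
    D          : Matrix (suc n) (suc n)
    isInstance : IsTSPInstance D
    OPT>0      : Below (OPT-TSP D) 0ℝ

integralityGap : (r s : ∀ n → Fin (suc n)) → LowerReal
integralityGap r s = ⨆ λ (P : Instance) → let open Instance P in
  OPT-TSP D ÷ OPT-SDP₂ (r n) (s n) D

-- The instance is the cut metric of a bipartition of 61 cities into parts of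
-- 10 and 51 cities, with s in the large part. A tour crosses the cut at least
-- twice. For the relaxation, let each of the 60 positions lie in the small part
-- with probability 1/6, let two positions k, l both lie there with "probability"
-- κ k l / 6, and place the cities of each part uniformly. Here κ is the Gram
-- matrix of the 60 cyclic translates of a smooth bump. It is entrywise nonnegative
-- with constant row sums, hence the quadratic form is a sum of Laplacians and
-- squares. Consecutive translates nearly coincide, so the path on the 60 positions
-- crosses the cut at most 5/8 times; the two edges at s add 1/3, and 5/8 + 1/3 < 1.

module Submission where

open import Defs
  renaming (_+_ to _+ʳ_; _*_ to _*ʳ_; _-_ to _-ʳ_; -_ to -ʳ_; _≤_ to _≤ʳ_; _<_ to _<ʳ_; sum to sumʳ)
open import Data.Nat as ℕ using (ℕ; zero; suc)
open import Data.Fin using (Fin; zero; suc; _↑ˡ_; _↑ʳ_; combine; quotient; remainder; toℕ; punchIn; punchOut)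

open import Algebra.Bundles using (CommutativeRing)
import Algebra.Properties.Semiring.Mult as SemiringMult
import Algebra.Properties.Semiring.Sum as SemiringSum
open import Data.Bool using (Bool; true; false; _∨_; _xor_; if_then_else_; not)
open import Data.Fin.Permutation using (_⟨$⟩ʳ_; _⟨$⟩ˡ_; inverseʳ)
open import Data.Fin.Properties
  using (_≟_; all?; combine-remQuot; remQuot-combine; punchIn-injective; punchInᵢ≢i; punchOut-cong;
         punchOut-punchIn; toℕ-fromℕ<; toℕ-injective; toℕ<n)
open import Data.Integer using (+_)
open import Data.Nat.DivMod using (_%_; _mod_; %-distribˡ-+; m%n%n≡m%n; m%n<n; m<n⇒m%n≡m; [m+n]%n≡m%n)
import Data.Nat.Properties as ℕ
open import Data.Product using (∃-syntax; _×_; _,_; proj₁; proj₂)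
open import Data.Rational using (ℚ; 0ℚ; 1ℚ; ½; _+_; _*_; _-_; -_; _≤_; _/_; nonNegative)
import Data.Rational.Properties as ℚ
open import Data.Rational.Solver using (module +-*-Solver)
open import Data.Sum using (_⊎_; inj₁; inj₂; map₂)
import Data.Vec.Functional as Vector
open import Function using (_∘_; flip; const)
open import Relation.Binary.PropositionalEquality
  using (_≡_; _≢_; refl; sym; trans; cong; cong₂; subst; module ≡-Reasoning)
open import Relation.Nullary using (Dec; contradiction)
open import Relation.Nullary.Decidable using (⌊_⌋; yes; no; toWitness; _⊎-dec_)

-- For genuine random events of probability 1/6, 1 - κ would be a metric. The program constrains
-- pair probabilities only through linear equations, signs and semidefiniteness. Here 1 - κ is half
-- the squared distance of two unit vectors, hence quadratically small for a unit shift: each step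
-- costs 1/32, yet twelve steps reach a translate of disjoint support, where 1 - κ = 1. This failure
-- of the triangle inequality makes the relaxed tour cheap. The main obstacle is semidefiniteness.
-- The matrix is invariant under permuting the cities of a part. Split a vector into its
-- restrictions P and Q to the two parts, with sums U and V over the cities. The fluctuation inside
-- a part is M times the sum of the Laplacian forms of its cities minus the Laplacian form of their
-- sum, nonnegative by Cauchy-Schwarz. What remains depends on U and V only: the form of κ - 1/6 at
-- U - V/5, and a square of the total. That κ - 1/6 is semidefinite is the covariance condition for
-- events of probability 1/6. Since r and s are prescribed, the bipartition is built around s, and
-- the facts about positions are established for every r.

module ℚ-Sum = SemiringSum (CommutativeRing.semiring ℚ.+-*-commutativeRing)
open SemiringMult (CommutativeRing.semiring ℚ.+-*-commutativeRing)
  using (×-homo-+; ×1-homo-*; ×-assoc-*) renaming (_×_ to _⋆_)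
open +-*-Solver using (solve; _:=_; _:+_; _:*_; _:-_; :-_; con; Polynomial)

-- Finite sums

indicator : Bool → ℚ
indicator b = if b then 1ℚ else 0ℚ

δ : ∀ {n} → Fin n → Fin n → ℚ
δ i j = indicator ⌊ i ≟ j ⌋

δ-refl : ∀ {n} (i : Fin n) → δ i i ≡ 1ℚ
δ-refl i with i ≟ i
... | yes _  = refl
... | no i≢i with () ← i≢i refl

δ-suc : ∀ {n} (i j : Fin n) → δ (suc i) (suc j) ≡ δ i j
δ-suc i j with i ≟ j
... | yes _ = refl
... | no  _ = refl

δ-sym : ∀ {n} (i j : Fin n) → δ i j ≡ δ j i
δ-sym i j with i ≟ j
... | yes refl = sym (δ-refl i)
... | no i≢j with j ≟ i
...   | yes j≡i with () ← i≢j (sym j≡i)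
...   | no _ = refl

abstract
  -- Abstract, so that sums stay symbolic and are handled through the laws below alone.
  sum : ∀ {n} → (Fin n → ℚ) → ℚ
  sum = ℚ-Sum.sum

  sum-empty : (f : Fin 0 → ℚ) → sum f ≡ 0ℚ
  sum-empty _ = refl

  sum-suc : ∀ {n} (f : Fin (suc n) → ℚ) → sum f ≡ f zero + sum (f ∘ suc)
  sum-suc _ = refl

  sum-cong : ∀ {n} {f g : Fin n → ℚ} → (∀ i → f i ≡ g i) → sum f ≡ sum g
  sum-cong = ℚ-Sum.sum-cong-≗

  sum-+ : ∀ {n} (f g : Fin n → ℚ) → sum (λ i → f i + g i) ≡ sum f + sum g
  sum-+ = ℚ-Sum.∑-distrib-+

  sum-comm : ∀ {m n} (f : Fin m → Fin n → ℚ) →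
             sum (λ i → sum (f i)) ≡ sum (λ j → sum (flip f j))
  sum-comm = ℚ-Sum.∑-comm

  sum-*ˡ : ∀ {n} q (f : Fin n → ℚ) → sum (λ i → q * f i) ≡ q * sum f
  sum-*ˡ q f = sym (ℚ-Sum.*-distribˡ-sum q f)

  sum-*ʳ : ∀ {n} q (f : Fin n → ℚ) → sum (λ i → f i * q) ≡ sum f * q
  sum-*ʳ q f = sym (ℚ-Sum.*-distribʳ-sum q f)

  sum-zero : ∀ n → sum {n} (const 0ℚ) ≡ 0ℚ
  sum-zero = ℚ-Sum.sum-replicate-zero

  sum-const : ∀ n q → sum {n} (const q) ≡ (n ⋆ 1ℚ) * q
  sum-const n q = trans (ℚ-Sum.sum-replicate n)
    (sym (trans (×-assoc-* n 1ℚ q) (cong (n ⋆_) (ℚ.*-identityˡ q))))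

  sum-mono : ∀ {n} {f g : Fin n → ℚ} → (∀ i → f i ≤ g i) → sum f ≤ sum g
  sum-mono {zero}  _   = ℚ.≤-refl
  sum-mono {suc n} f≤g = ℚ.+-mono-≤ (f≤g zero) (sum-mono (f≤g ∘ suc))

  sum-δ : ∀ {n} i (f : Fin n → ℚ) → sum (λ j → δ i j * f j) ≡ f i
  sum-δ {suc n} zero f = trans (cong₂ _+_ (ℚ.*-identityˡ (f zero))
      (trans (sum-cong {n} λ j → ℚ.*-zeroˡ (f (suc j))) (sum-zero n)))
    (ℚ.+-identityʳ (f zero))
  sum-δ {suc n} (suc i) f = trans (cong₂ _+_ (ℚ.*-zeroˡ (f zero))
      (trans (sum-cong {n} λ j → cong (_* f (suc j)) (δ-suc i j)) (sum-δ i (f ∘ suc))))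
    (ℚ.+-identityˡ (f (suc i)))

  sum-split : ∀ m {n} (f : Fin (m ℕ.+ n) → ℚ) →
              sum f ≡ sum (λ i → f (i ↑ˡ n)) + sum (λ j → f (m ↑ʳ j))
  sum-split zero    f = sym (ℚ.+-identityˡ (sum f))
  sum-split (suc m) f = trans (cong (λ s → f zero + s) (sum-split m (f ∘ suc))) (sym (ℚ.+-assoc (f zero) _ _))

  seq-sum : ∀ {n} (f : Fin n → ℝ) N → seq (sumʳ f) N ≡ sum (λ i → seq (f i) N)
  seq-sum {zero}  f N = refl
  seq-sum {suc n} f N = cong (λ s → seq (f zero) N + s) (seq-sum (f ∘ suc) N)

  ∑∑-combine : ∀ m {n} (f : Fin (m ℕ.* n) → ℚ) → sum f ≡ sum (λ (i : Fin m) → sum (λ j → f (combine i j)))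
  ∑∑-combine zero        f = refl
  ∑∑-combine (suc m) {n} f = trans (sum-split n f)
    (cong (λ s → sum (λ i → f (i ↑ˡ m ℕ.* n)) + s) (∑∑-combine m (λ j → f (n ↑ʳ j))))

sum-nonneg : ∀ {n} {f : Fin n → ℚ} → (∀ i → 0ℚ ≤ f i) → 0ℚ ≤ sum f
sum-nonneg {n} {f} 0≤f = subst (_≤ sum f) (sum-zero n) (sum-mono 0≤f)

*-nonneg : ∀ {p q} → 0ℚ ≤ p → 0ℚ ≤ q → 0ℚ ≤ p * q
*-nonneg {p} {q} 0≤p 0≤q = subst (_≤ p * q) (ℚ.*-zeroʳ p)
  (ℚ.*-monoˡ-≤-nonNeg p {{nonNegative 0≤p}} 0≤q)

+-nonneg : ∀ {p q} → 0ℚ ≤ p → 0ℚ ≤ q → 0ℚ ≤ p + q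
+-nonneg = ℚ.+-mono-≤

square-nonneg : ∀ q → 0ℚ ≤ q * q
square-nonneg q with ℚ.≤-total 0ℚ q
... | inj₁ 0≤q = *-nonneg 0≤q 0≤q
... | inj₂ q≤0 = subst (0ℚ ≤_) (solve 1 (λ x → (:- x) :* (:- x) := x :* x) refl q)
                       (*-nonneg 0≤-q 0≤-q)
  where
  0≤-q : 0ℚ ≤ - q
  0≤-q = ℚ.neg-antimono-≤ q≤0

diff-nonneg⇒≤ : ∀ {p q} → 0ℚ ≤ q - p → p ≤ q
diff-nonneg⇒≤ {p} {q} 0≤q-p = subst (p ≤_) (solve 2 (λ p q → p :+ (q :- p) := q) refl p q)
  (subst (_≤ p + (q - p)) (ℚ.+-identityʳ p) (ℚ.+-monoʳ-≤ p 0≤q-p))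

≤⇒diff-nonneg : ∀ {p q} → p ≤ q → 0ℚ ≤ q - p
≤⇒diff-nonneg {p} {q} p≤q = subst (_≤ q - p) (ℚ.+-inverseʳ p) (ℚ.+-monoˡ-≤ (- p) p≤q)

∑∑ : ∀ {m n} → (Fin m → Fin n → ℚ) → ℚ
∑∑ f = sum λ i → sum λ j → f i j

∑∑-cong : ∀ {m n} {f g : Fin m → Fin n → ℚ} → (∀ i j → f i j ≡ g i j) → ∑∑ f ≡ ∑∑ g
∑∑-cong f≡g = sum-cong λ i → sum-cong (f≡g i)

∑∑-+ : ∀ {m n} (f g : Fin m → Fin n → ℚ) → ∑∑ (λ i j → f i j + g i j) ≡ ∑∑ f + ∑∑ g
∑∑-+ f g = trans (sum-cong λ i → sum-+ (f i) (g i)) (sum-+ (sum ∘ f) (sum ∘ g))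

∑∑-*ˡ : ∀ {m n} q (f : Fin m → Fin n → ℚ) → ∑∑ (λ i j → q * f i j) ≡ q * ∑∑ f
∑∑-*ˡ q f = trans (sum-cong λ i → sum-*ˡ q (f i)) (sum-*ˡ q (sum ∘ f))

∑∑-product : ∀ {m n} (f : Fin m → ℚ) (g : Fin n → ℚ) → ∑∑ (λ i j → f i * g j) ≡ sum f * sum g
∑∑-product f g = trans (sum-cong λ i → sum-*ˡ (f i) g) (sum-*ʳ (sum g) f)

∑∑-mono : ∀ {m n} {f g : Fin m → Fin n → ℚ} → (∀ i j → f i j ≤ g i j) → ∑∑ f ≤ ∑∑ g
∑∑-mono f≤g = sum-mono λ i → sum-mono (f≤g i)

sum-δʳ : ∀ {n} j (f : Fin n → ℚ) → sum (λ i → δ i j * f i) ≡ f j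
sum-δʳ j f = trans (sum-cong λ i → cong (_* f i) (δ-sym i j)) (sum-δ j f)

sum-pairs : ∀ {m n} (f : Fin m → Fin n → ℚ) →
            sum (λ a → f (quotient {m} n a) (remainder {m} n a)) ≡ ∑∑ f
sum-pairs {m} {n} f = trans (∑∑-combine m {n} _) (∑∑-cong λ i j →
  cong (λ p → f (proj₁ p) (proj₂ p)) (remQuot-combine {m} {n} i j))

-- Bilinear forms of kernels

Form : ∀ {n} → (Fin n → Fin n → ℚ) → (Fin n → ℚ) → (Fin n → ℚ) → ℚ
Form K x y = ∑∑ λ k l → K k l * (x k * y l)

-- The defect is half the sum of the squares of all two-by-two minors (Lagrange's identity), so no
-- norm has to be inverted.
cauchySchwarz : ∀ {n} (a z : Fin n → ℚ) →
  sum (λ i → a i * z i) * sum (λ i → a i * z i) ≤ sum (λ i → a i * a i) * sum (λ i → z i * z i)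
cauchySchwarz a z = diff-nonneg⇒≤ (subst (0ℚ ≤_) lagrange
    (*-nonneg (ℚ.nonNegative⁻¹ ½) (sum-nonneg λ i → sum-nonneg λ j →
      square-nonneg (a i * z j - a j * z i))))
  where
  open ≡-Reasoning
  A Z C : ℚ
  A = sum λ i → a i * a i
  Z = sum λ i → z i * z i
  C = sum λ i → a i * z i
  lagrange : ½ * ∑∑ (λ i j → (a i * z j - a j * z i) * (a i * z j - a j * z i)) ≡ A * Z - C * C
  lagrange = begin
    ½ * ∑∑ (λ i j → (a i * z j - a j * z i) * (a i * z j - a j * z i))
      ≡⟨ cong (½ *_) (∑∑-cong λ i j → solve 4 (λ x y u v →
           (x :* v :- y :* u) :* (x :* v :- y :* u)
             := ((x :* x) :* (v :* v) :+ (u :* u) :* (y :* y)) :+ con (- (+ 2 / 1)) :* ((x :* u) :* (y :* v)))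
           refl (a i) (a j) (z i) (z j)) ⟩
    ½ * ∑∑ (λ i j → ((a i * a i) * (z j * z j) + (z i * z i) * (a j * a j))
                     + (- (+ 2 / 1)) * ((a i * z i) * (a j * z j)))
      ≡⟨ cong (½ *_) (trans (∑∑-+ (λ i j → (a i * a i) * (z j * z j) + (z i * z i) * (a j * a j)) _)
           (cong₂ _+_ (trans (∑∑-+ (λ i j → (a i * a i) * (z j * z j)) _)
                         (cong₂ _+_ (∑∑-product (λ i → a i * a i) (λ i → z i * z i))
                                    (∑∑-product (λ i → z i * z i) (λ i → a i * a i))))
                      (trans (∑∑-*ˡ (- (+ 2 / 1)) _) (cong ((- (+ 2 / 1)) *_)
                        (∑∑-product (λ i → a i * z i) (λ i → a i * z i)))))) ⟩
    ½ * ((A * Z + Z * A) + (- (+ 2 / 1)) * (C * C))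
      ≡⟨ solve 3 (λ A Z C → con ½ :* ((A :* Z :+ Z :* A) :+ con (- (+ 2 / 1)) :* (C :* C)) := A :* Z :- C :* C) refl A Z C ⟩
    A * Z - C * C ∎

-- Fourfold sums over two cities and two positions

colSum : ∀ {m n} → (Fin m → Fin n → ℚ) → Fin n → ℚ
colSum P k = sum λ i → P i k

-- The index order follows two pairs (i, k) and (j, l): in the application i and j are cities, k and
-- l positions.
∑⁴ : ∀ {m n} → (Fin m → Fin n → Fin m → Fin n → ℚ) → ℚ
∑⁴ f = ∑∑ λ i k → ∑∑ (f i k)

∑∑-comm : ∀ {m n} (f : Fin m → Fin n → ℚ) → ∑∑ f ≡ ∑∑ (flip f)
∑∑-comm = sum-comm

module _ {m n : ℕ} where

  ∑⁴-cong : {f g : Fin m → Fin n → Fin m → Fin n → ℚ} →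
            (∀ i k j l → f i k j l ≡ g i k j l) → ∑⁴ f ≡ ∑⁴ g
  ∑⁴-cong f≡g = ∑∑-cong λ i k → ∑∑-cong (f≡g i k)

  ∑⁴-+ : (f g : Fin m → Fin n → Fin m → Fin n → ℚ) →
         ∑⁴ (λ i k j l → f i k j l + g i k j l) ≡ ∑⁴ f + ∑⁴ g
  ∑⁴-+ f g = trans (∑∑-cong λ i k → ∑∑-+ (f i k) (g i k))
    (∑∑-+ (λ i k → ∑∑ (f i k)) (λ i k → ∑∑ (g i k)))

  ∑⁴-*ˡ : ∀ q (f : Fin m → Fin n → Fin m → Fin n → ℚ) →
          ∑⁴ (λ i k j l → q * f i k j l) ≡ q * ∑⁴ f
  ∑⁴-*ˡ q f = trans (∑∑-cong λ i k → ∑∑-*ˡ q (f i k)) (∑∑-*ˡ q (λ i k → ∑∑ (f i k)))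

  ∑⁴-δˡ : (f : Fin m → Fin n → Fin m → Fin n → ℚ) →
          ∑⁴ (λ i k j l → δ i j * f i k j l) ≡ ∑∑ (λ i k → sum (f i k i))
  ∑⁴-δˡ f = ∑∑-cong λ i k → trans (sum-cong λ j → sum-*ˡ (δ i j) (f i k j)) (sum-δ i _)

  ∑⁴-δʳ : (f : Fin m → Fin n → Fin m → Fin n → ℚ) →
          ∑⁴ (λ i k j l → δ k l * f i k j l) ≡ ∑∑ (λ i k → sum λ j → f i k j k)
  ∑⁴-δʳ f = ∑∑-cong λ i k → sum-cong λ j → sum-δ k (f i k j)

  ∑⁴-δδ : (f : Fin m → Fin n → Fin m → Fin n → ℚ) →
          ∑⁴ (λ i k j l → δ i j * (δ k l * f i k j l)) ≡ ∑∑ (λ i k → f i k i k)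
  ∑⁴-δδ f = trans (∑⁴-δˡ λ i k j l → δ k l * f i k j l) (∑∑-cong λ i k → sum-δ k (f i k i))

  ∑⁴-product : (f : Fin m → Fin m → ℚ) (g : Fin n → Fin n → ℚ) →
               ∑⁴ (λ i k j l → f i j * g k l) ≡ ∑∑ f * ∑∑ g
  ∑⁴-product f g = trans (∑∑-cong λ i k → ∑∑-product (f i) (g k))
    (∑∑-product (sum ∘ f) (sum ∘ g))

  -- A kernel that looks only at the positions lets both city indices be summed out, so nothing but
  -- the column sums survives.
  ∑⁴-Form : ∀ K (P R : Fin m → Fin n → ℚ) →
            ∑⁴ (λ i k j l → K k l * (P i k * R j l)) ≡ Form K (colSum P) (colSum R)
  ∑⁴-Form K P R = begin
    ∑⁴ (λ i k j l → K k l * (P i k * R j l))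
      ≡⟨ ∑∑-cong (λ i k → ∑∑-comm λ j l → K k l * (P i k * R j l)) ⟩
    ∑∑ (λ i k → ∑∑ λ l j → K k l * (P i k * R j l))
      ≡⟨ ∑∑-cong (λ i k → sum-cong λ l → trans
           (sum-cong λ j → sym (ℚ.*-assoc (K k l) (P i k) (R j l)))
           (trans (sum-*ˡ (K k l * P i k) (λ j → R j l)) (ℚ.*-assoc (K k l) (P i k) (colSum R l)))) ⟩
    ∑∑ (λ i k → sum λ l → K k l * (P i k * colSum R l))
      ≡⟨ ∑∑-comm (λ i k → sum λ l → K k l * (P i k * colSum R l)) ⟩
    ∑∑ (λ k i → sum λ l → K k l * (P i k * colSum R l))
      ≡⟨ sum-cong (λ k → ∑∑-comm λ i l → K k l * (P i k * colSum R l)) ⟩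
    ∑∑ (λ k l → sum λ i → K k l * (P i k * colSum R l))
      ≡⟨ ∑∑-cong (λ k l → trans (sum-*ˡ (K k l) (λ i → P i k * colSum R l))
           (cong (K k l *_) (sum-*ʳ (colSum R l) (λ i → P i k)))) ⟩
    Form K (colSum P) (colSum R) ∎
    where open ≡-Reasoning

sqNorm : ∀ {n} → (Fin n → ℚ) → ℚ
sqNorm x = sum λ k → x k * x k

-- Inclusion and exclusion over the two block diagonals.
∑⁴-offDiagonal : ∀ {m n} (K : Fin n → Fin n → ℚ) d (P : Fin m → Fin n → ℚ) → (∀ k → K k k ≡ d) →
  ∑⁴ (λ i k j l → ((1ℚ - δ i j) * (1ℚ - δ k l)) * (K k l * (P i k * P j l)))
    ≡ ((Form K (colSum P) (colSum P) - sum (λ i → Form K (P i) (P i))) - d * sqNorm (colSum P))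
      + d * sum (λ i → sqNorm (P i))
∑⁴-offDiagonal {m} {n} K d P K-diag = begin
  ∑⁴ (λ i k j l → ((1ℚ - δ i j) * (1ℚ - δ k l)) * f i k j l)
    ≡⟨ ∑⁴-cong (λ i k j l → solve 3 (λ a b z →
         ((con 1ℚ :- a) :* (con 1ℚ :- b)) :* z
           := (z :+ con (- 1ℚ) :* (a :* z)) :+ (con (- 1ℚ) :* (b :* z) :+ a :* (b :* z)))
         refl (δ i j) (δ k l) (f i k j l)) ⟩
  ∑⁴ (λ i k j l → (f i k j l + (- 1ℚ) * (δ i j * f i k j l))
                  + ((- 1ℚ) * (δ k l * f i k j l) + δ i j * (δ k l * f i k j l)))
    ≡⟨ trans (∑⁴-+ (λ i k j l → f i k j l + (- 1ℚ) * (δ i j * f i k j l))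
                   (λ i k j l → (- 1ℚ) * (δ k l * f i k j l) + δ i j * (δ k l * f i k j l)))
         (cong₂ _+_
           (trans (∑⁴-+ f (λ i k j l → (- 1ℚ) * (δ i j * f i k j l)))
             (cong₂ _+_ (∑⁴-Form K P P)
               (trans (∑⁴-*ˡ (- 1ℚ) (λ i k j l → δ i j * f i k j l)) (cong ((- 1ℚ) *_) (∑⁴-δˡ f)))))
           (trans (∑⁴-+ (λ i k j l → (- 1ℚ) * (δ k l * f i k j l)) (λ i k j l → δ i j * (δ k l * f i k j l)))
             (cong₂ _+_
               (trans (∑⁴-*ˡ (- 1ℚ) (λ i k j l → δ k l * f i k j l))
                 (cong ((- 1ℚ) *_) (trans (∑⁴-δʳ f) column)))
               (trans (∑⁴-δδ f) diagonal)))) ⟩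
  (F + (- 1ℚ) * G) + ((- 1ℚ) * (d * S) + d * T)
    ≡⟨ solve 5 (λ F G d S T → (F :+ con (- 1ℚ) :* G) :+ (con (- 1ℚ) :* (d :* S) :+ d :* T)
         := ((F :- G) :- d :* S) :+ d :* T) refl F G d S T ⟩
  ((F - G) - d * S) + d * T ∎
  where
  open ≡-Reasoning
  f : Fin m → Fin n → Fin m → Fin n → ℚ
  f i k j l = K k l * (P i k * P j l)
  F G S T : ℚ
  F = Form K (colSum P) (colSum P)
  G = sum λ i → Form K (P i) (P i)
  S = sqNorm (colSum P)
  T = sum λ i → sqNorm (P i)
  diagonal : ∑∑ (λ i k → f i k i k) ≡ d * T
  diagonal = trans (∑∑-cong λ i k → cong (_* (P i k * P i k)) (K-diag k)) (∑∑-*ˡ d (λ i k → P i k * P i k))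
  column : ∑∑ (λ i k → sum λ j → f i k j k) ≡ d * S
  column = begin
    ∑∑ (λ i k → sum λ j → f i k j k)
      ≡⟨ ∑∑-cong (λ i k → sum-cong λ j → cong (_* (P i k * P j k)) (K-diag k)) ⟩
    ∑∑ (λ i k → sum λ j → d * (P i k * P j k))
      ≡⟨ ∑∑-cong (λ i k → trans (sum-*ˡ d (λ j → P i k * P j k))
           (cong (d *_) (sum-*ˡ (P i k) (λ j → P j k)))) ⟩
    ∑∑ (λ i k → d * (P i k * colSum P k))
      ≡⟨ ∑∑-*ˡ d (λ i k → P i k * colSum P k) ⟩
    d * ∑∑ (λ i k → P i k * colSum P k)
      ≡⟨ cong (d *_) (∑∑-comm λ i k → P i k * colSum P k) ⟩
    d * ∑∑ (λ k i → P i k * colSum P k)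
      ≡⟨ cong (d *_) (sum-cong λ k → sum-*ʳ (colSum P k) (λ i → P i k)) ⟩
    d * S ∎

-- Laplacians of kernels with constant row sums

module _ {n : ℕ} (K : Fin n → Fin n → ℚ) (R : ℚ) where

  -- The Laplacian form of the weighted graph `K`, once every row of `K` sums to `R`: its degree
  -- matrix is then `R` times the identity.
  laplacian : (Fin n → ℚ) → ℚ
  laplacian x = R * sqNorm x - Form K x x

  module _ (K-sym : ∀ k l → K k l ≡ K l k) (K-row : ∀ k → sum (K k) ≡ R) where

    laplacian-sum : ∀ x → laplacian x ≡ ½ * ∑∑ (λ k l → K k l * ((x k - x l) * (x k - x l)))
    laplacian-sum x = sym (begin
      ½ * ∑∑ (λ k l → K k l * ((x k - x l) * (x k - x l)))
        ≡⟨ cong (½ *_) (∑∑-cong λ k l → solve 3 (λ a x y → a :* ((x :- y) :* (x :- y))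
             := (a :* (x :* x) :+ a :* (y :* y)) :+ con (- (+ 2 / 1)) :* (a :* (x :* y)))
             refl (K k l) (x k) (x l)) ⟩
      ½ * ∑∑ (λ k l → (K k l * (x k * x k) + K k l * (x l * x l)) + (- (+ 2 / 1)) * (K k l * (x k * x l)))
        ≡⟨ cong (½ *_) (trans (∑∑-+ (λ k l → K k l * (x k * x k) + K k l * (x l * x l))
                                    (λ k l → (- (+ 2 / 1)) * (K k l * (x k * x l))))
             (cong₂ _+_ (trans (∑∑-+ (λ k l → K k l * (x k * x k)) (λ k l → K k l * (x l * x l)))
                          (cong₂ _+_ left right))
                        (∑∑-*ˡ (- (+ 2 / 1)) (λ k l → K k l * (x k * x l))))) ⟩
      ½ * ((R * sqNorm x + R * sqNorm x) + (- (+ 2 / 1)) * Form K x x)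
        ≡⟨ solve 2 (λ a f → con ½ :* ((a :+ a) :+ con (- (+ 2 / 1)) :* f) := a :- f)
             refl (R * sqNorm x) (Form K x x) ⟩
      laplacian x ∎)
      where
      open ≡-Reasoning
      left : ∑∑ (λ k l → K k l * (x k * x k)) ≡ R * sqNorm x
      left = trans (sum-cong λ k → trans (sum-*ʳ (x k * x k) (K k)) (cong (_* (x k * x k)) (K-row k)))
        (sum-*ˡ R (λ k → x k * x k))
      right : ∑∑ (λ k l → K k l * (x l * x l)) ≡ R * sqNorm x
      right = trans (∑∑-comm λ k l → K k l * (x l * x l))
        (trans (∑∑-cong λ l k → cong (_* (x l * x l)) (K-sym k l)) left)

    -- Both sides are `K`-weighted sums of squared differences over pairs (k, l), so nonnegative
    -- weights reduce the claim to a single pair. There it is Cauchy-Schwarz against `u`. Pairing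
    -- with a mask `u` that fixes `P`, instead of the all-ones vector, yields the size of one part
    -- as the factor `M`; with a larger factor the decomposition into squares would not balance.
    laplacian-colSum : (∀ k l → 0ℚ ≤ K k l) → ∀ {m} (u : Fin m → ℚ) M → sqNorm u ≡ M →
      (P : Fin m → Fin n → ℚ) → (∀ i k → u i * P i k ≡ P i k) →
      laplacian (colSum P) ≤ M * sum (λ i → laplacian (P i))
    laplacian-colSum K≥0 u M |u|² P uP≡P = begin
      laplacian (colSum P)
        ≡⟨ laplacian-sum (colSum P) ⟩
      ½ * ∑∑ (λ k l → K k l * ((colSum P k - colSum P l) * (colSum P k - colSum P l)))
        ≤⟨ ℚ.*-monoˡ-≤-nonNeg ½ (∑∑-mono λ k l →
             ℚ.*-monoˡ-≤-nonNeg (K k l) {{nonNegative (K≥0 k l)}} (spread k l)) ⟩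
      ½ * ∑∑ (λ k l → K k l * (M * sum (λ i → z i k l * z i k l)))
        ≡⟨ cong (½ *_) (∑∑-cong λ k l → trans
             (solve 3 (λ a b c → a :* (b :* c) := b :* (a :* c)) refl (K k l) M (sum λ i → z i k l * z i k l))
             (cong (M *_) (sym (sum-*ˡ (K k l) (λ i → z i k l * z i k l))))) ⟩
      ½ * ∑∑ (λ k l → M * sum (λ i → K k l * (z i k l * z i k l)))
        ≡⟨ cong (½ *_) (trans (∑∑-*ˡ M (λ k l → sum (λ i → K k l * (z i k l * z i k l))))
             (cong (M *_) (trans (sum-cong λ k → sum-comm λ l i → K k l * (z i k l * z i k l))
                                 (sum-comm λ k i → sum λ l → K k l * (z i k l * z i k l))))) ⟩
      ½ * (M * sum (λ i → ∑∑ λ k l → K k l * (z i k l * z i k l)))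
        ≡⟨ solve 3 (λ a b c → a :* (b :* c) := b :* (a :* c)) refl ½ M
             (sum (λ i → ∑∑ λ k l → K k l * (z i k l * z i k l))) ⟩
      M * (½ * sum (λ i → ∑∑ λ k l → K k l * (z i k l * z i k l)))
        ≡⟨ cong (M *_) (trans (sym (sum-*ˡ ½ (λ i → ∑∑ λ k l → K k l * (z i k l * z i k l))))
             (sum-cong λ i → sym (laplacian-sum (P i)))) ⟩
      M * sum (λ i → laplacian (P i)) ∎
      where
      open ℚ.≤-Reasoning
      z : Fin _ → Fin n → Fin n → ℚ
      z i k l = P i k - P i l
      difference : ∀ k l → sum (λ i → u i * z i k l) ≡ colSum P k - colSum P l
      difference k l = trans
        (sum-cong λ i → trans
          (solve 3 (λ u a b → u :* (a :- b) := u :* a :+ con (- 1ℚ) :* (u :* b)) refl (u i) (P i k) (P i l))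
          (cong₂ (λ a b → a + (- 1ℚ) * b) (uP≡P i k) (uP≡P i l)))
        (trans (sum-+ (λ i → P i k) (λ i → (- 1ℚ) * P i l))
          (trans (cong (λ s → colSum P k + s) (sum-*ˡ (- 1ℚ) (λ i → P i l)))
            (solve 2 (λ a b → a :+ con (- 1ℚ) :* b := a :- b) refl (colSum P k) (colSum P l))))
      spread : ∀ k l → (colSum P k - colSum P l) * (colSum P k - colSum P l)
                       ≤ M * sum (λ i → z i k l * z i k l)
      spread k l = begin
        (colSum P k - colSum P l) * (colSum P k - colSum P l)
          ≡⟨ cong₂ _*_ (sym (difference k l)) (sym (difference k l)) ⟩
        sum (λ i → u i * z i k l) * sum (λ i → u i * z i k l)
          ≤⟨ cauchySchwarz u (λ i → z i k l) ⟩
        sqNorm u * sum (λ i → z i k l * z i k l)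
          ≡⟨ cong (_* sum (λ i → z i k l * z i k l)) |u|² ⟩
        M * sum (λ i → z i k l * z i k l) ∎

-- Reals compared index by index of their sequences

≤-pointwise : ∀ {x y} → (∀ N → seq x N ≤ seq y N) → x ≤ʳ y
≤-pointwise {x} {y} x≤y = mk≤ λ ε 0<ε → 0 , λ N _ → begin
  seq x N      ≤⟨ x≤y N ⟩
  seq y N      ≡⟨ ℚ.+-identityʳ (seq y N) ⟨
  seq y N + 0ℚ ≤⟨ ℚ.+-monoʳ-≤ (seq y N) (ℚ.<⇒≤ 0<ε) ⟩
  seq y N + ε  ∎
  where open ℚ.≤-Reasoning

≈-pointwise : ∀ {x y} → (∀ N → seq x N ≡ seq y N) → x ≈ y
≈-pointwise x≡y = mk≈ (≤-pointwise λ N → ℚ.≤-reflexive (x≡y N))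
                      (≤-pointwise λ N → ℚ.≤-reflexive (sym (x≡y N)))

seq-𝟙 : ∀ b N → seq (𝟙 b) N ≡ indicator b
seq-𝟙 true  N = refl
seq-𝟙 false N = refl

indicator-nonneg : ∀ b → 0ℚ ≤ indicator b
indicator-nonneg true  = ℚ.nonNegative⁻¹ 1ℚ
indicator-nonneg false = ℚ.≤-refl

indicator-≤1 : ∀ b → indicator b ≤ 1ℚ
indicator-≤1 true  = ℚ.≤-refl
indicator-≤1 false = ℚ.nonNegative⁻¹ 1ℚ

seq-∑⁴ : ∀ {n} (F : Fin (n ℕ.* n) → Fin (n ℕ.* n) → ℝ) (f : Fin n → Fin n → Fin n → Fin n → ℚ) (N : ℕ) →
         (∀ a b → seq (F a b) N ≡ f (quotient n a) (remainder {n} n a) (quotient n b) (remainder {n} n b)) →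
         seq (sumʳ λ a → sumʳ (F a)) N ≡ ∑⁴ f
seq-∑⁴ {n} F f N F≡f = begin
  seq (sumʳ λ a → sumʳ (F a)) N
    ≡⟨ trans (seq-sum (λ a → sumʳ (F a)) N) (sum-cong λ a → seq-sum (F a) N) ⟩
  ∑∑ (λ a b → seq (F a b) N)
    ≡⟨ ∑∑-cong F≡f ⟩
  ∑∑ (λ a b → f (quotient n a) (remainder {n} n a) (quotient n b) (remainder {n} n b))
    ≡⟨ sum-cong (λ a → sum-pairs (f (quotient n a) (remainder {n} n a))) ⟩
  sum (λ a → ∑∑ (f (quotient n a) (remainder {n} n a)))
    ≡⟨ sum-pairs (λ i k → ∑∑ (f i k)) ⟩
  ∑⁴ f ∎
  where open ≡-Reasoning

-- Forms of affine kernels and of combined vectors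

affine : ∀ {n} → ℚ → ℚ → (Fin n → Fin n → ℚ) → Fin n → Fin n → ℚ
affine a b K k l = a + b * K k l

Form-affine : ∀ {n} a b K (x y : Fin n → ℚ) →
              Form (affine a b K) x y ≡ a * (sum x * sum y) + b * Form K x y
Form-affine a b K x y = trans
  (∑∑-cong λ k l → solve 4 (λ a b K z → (a :+ b :* K) :* z := a :* z :+ b :* (K :* z)) refl a b (K k l) (x k * y l))
  (trans (∑∑-+ (λ k l → a * (x k * y l)) (λ k l → b * (K k l * (x k * y l))))
    (cong₂ _+_ (trans (∑∑-*ˡ a (λ k l → x k * y l)) (cong (a *_) (∑∑-product x y)))
               (∑∑-*ˡ b (λ k l → K k l * (x k * y l)))))

Form-sym : ∀ {n} {K : Fin n → Fin n → ℚ} → (∀ k l → K k l ≡ K l k) → ∀ x y → Form K x y ≡ Form K y x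
Form-sym {K = K} K-sym x y = trans (∑∑-comm λ k l → K k l * (x k * y l))
  (∑∑-cong λ l k → cong₂ _*_ (K-sym k l) (ℚ.*-comm (x k) (y l)))

Form-combination : ∀ {n} {K : Fin n → Fin n → ℚ} → (∀ k l → K k l ≡ K l k) → ∀ c x y →
  Form K (λ k → x k + c * y k) (λ k → x k + c * y k)
    ≡ (Form K x x + (c + c) * Form K x y) + (c * c) * Form K y y
Form-combination {K = K} K-sym c x y = begin
  Form K (λ k → x k + c * y k) (λ k → x k + c * y k)
    ≡⟨ ∑∑-cong (λ k l → solve 6 (λ K c x y x′ y′ →
         K :* ((x :+ c :* y) :* (x′ :+ c :* y′))
           := (K :* (x :* x′) :+ c :* (K :* (x :* y′) :+ K :* (y :* x′))) :+ (c :* c) :* (K :* (y :* y′)))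
         refl (K k l) c (x k) (y k) (x l) (y l)) ⟩
  ∑∑ (λ k l → (K k l * (x k * x l) + c * (K k l * (x k * y l) + K k l * (y k * x l)))
              + (c * c) * (K k l * (y k * y l)))
    ≡⟨ trans (∑∑-+ (λ k l → K k l * (x k * x l) + c * (K k l * (x k * y l) + K k l * (y k * x l)))
                   (λ k l → (c * c) * (K k l * (y k * y l))))
         (cong₂ _+_
           (trans (∑∑-+ (λ k l → K k l * (x k * x l)) (λ k l → c * (K k l * (x k * y l) + K k l * (y k * x l))))
             (cong (λ s → Form K x x + s)
               (trans (∑∑-*ˡ c (λ k l → K k l * (x k * y l) + K k l * (y k * x l)))
                 (cong (c *_) (trans (∑∑-+ (λ k l → K k l * (x k * y l)) (λ k l → K k l * (y k * x l)))
                   (cong (λ s → Form K x y + s) (Form-sym K-sym y x)))))))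
           (∑∑-*ˡ (c * c) (λ k l → K k l * (y k * y l)))) ⟩
  (Form K x x + c * (Form K x y + Form K x y)) + (c * c) * Form K y y
    ≡⟨ cong (λ s → (Form K x x + s) + (c * c) * Form K y y)
         (solve 2 (λ c z → c :* (z :+ z) := (c :+ c) :* z) refl c (Form K x y)) ⟩
  (Form K x x + (c + c) * Form K x y) + (c * c) * Form K y y ∎
  where open ≡-Reasoning

-- Entries of the relaxed solution

-- For a = δ i j, b = δ k l and q = κ k l: two distinct positions lie both in the
-- small part with probability q / 6, both in the large part with probability
-- (4 + q) / 6 and one in each with (1 - q) / 3; there are 10 · 9, 50 · 49 and
-- 2 · 10 · 50 ordered pairs of cities to share these.
weight : (a b q U V m : ℚ) → ℚ
weight a b q U V m = (+ 1 / 60) * ((a * b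
  + ((1ℚ - a) * (1ℚ - b)) * ((+ 1 / 9) * (q * U) + (+ 1 / 2450) * (((+ 40 / 1) + (+ 10 / 1) * q) * V)))
  + (+ 1 / 50) * ((1ℚ + (- 1ℚ) * q) * m))

weightᴾ : ∀ {n} (a b q U V m : Polynomial n) → Polynomial n
weightᴾ a b q U V m = con (+ 1 / 60) :* ((a :* b
  :+ ((con 1ℚ :- a) :* (con 1ℚ :- b))
    :* (con (+ 1 / 9) :* (q :* U) :+ con (+ 1 / 2450) :* ((con (+ 40 / 1) :+ con (+ 10 / 1) :* q) :* V)))
  :+ con (+ 1 / 50) :* ((con 1ℚ :+ con (- 1ℚ) :* q) :* m))

weight-diag : ∀ U V m → weight 1ℚ 1ℚ 1ℚ U V m ≡ + 1 / 60
weight-diag = solve 3 (λ U V m → weightᴾ (con 1ℚ) (con 1ℚ) (con 1ℚ) U V m := con (+ 1 / 60)) refl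

-- For a = 1 and b = 0 every summand dies separately: `a * b` through b, the same-part terms through
-- 1 - a, and the last one because a city never lies opposite itself.
weight-same-city : ∀ {a b m} q U V → a ≡ 0ℚ ⊎ (a ≡ 1ℚ × m ≡ 0ℚ) → b ≡ 0ℚ ⊎ b ≡ 1ℚ →
                   (a * (1ℚ - b)) * weight a b q U V m ≡ 0ℚ
weight-same-city {b = b} {m} q U V (inj₁ refl) _ =
  trans (cong (_* weight 0ℚ b q U V m) (ℚ.*-zeroˡ (1ℚ - b))) (ℚ.*-zeroˡ (weight 0ℚ b q U V m))
weight-same-city q U V (inj₂ (refl , refl)) (inj₂ refl) = ℚ.*-zeroˡ (weight 1ℚ 1ℚ q U V 0ℚ)
weight-same-city q U V (inj₂ (refl , refl)) (inj₁ refl) = solve 3 (λ q U V →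
  (con 1ℚ :* (con 1ℚ :- con 0ℚ)) :* weightᴾ (con 1ℚ) (con 0ℚ) q U V (con 0ℚ) := con 0ℚ) refl q U V

-- For a = 0 and b = 1 the last summand survives unless q = 1; this is where the unit diagonal of
-- the kernel enters.
weight-same-position : ∀ {a b q} U V m → a ≡ 0ℚ ⊎ a ≡ 1ℚ → b ≡ 0ℚ ⊎ (b ≡ 1ℚ × q ≡ 1ℚ) →
                       ((1ℚ - a) * b) * weight a b q U V m ≡ 0ℚ
weight-same-position {a} {q = q} U V m _ (inj₁ refl) =
  trans (cong (_* weight a 0ℚ q U V m) (ℚ.*-zeroʳ (1ℚ - a))) (ℚ.*-zeroˡ (weight a 0ℚ q U V m))
weight-same-position U V m (inj₂ refl) (inj₂ (refl , refl)) = ℚ.*-zeroˡ (weight 1ℚ 1ℚ 1ℚ U V m)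
weight-same-position U V m (inj₁ refl) (inj₂ (refl , refl)) = solve 3 (λ U V m →
  ((con 1ℚ :- con 0ℚ) :* con 1ℚ) :* weightᴾ (con 0ℚ) (con 1ℚ) (con 1ℚ) U V m := con 0ℚ) refl U V m

δ-cases : ∀ {n} (i j : Fin n) → δ i j ≡ 0ℚ ⊎ (i ≡ j × δ i j ≡ 1ℚ)
δ-cases i j with i ≟ j
... | yes i≡j = inj₂ (i≡j , refl)
... | no _    = inj₁ refl

-- Read κ k l / 6 as the probability that positions k and l both lie in the small part. Then `κ-row`
-- says that, given one position there, the expected number of positions there is 10. The covariance
-- of two indicators is (κ - 1/6) / 6, and `κ-centered` is the semidefiniteness of this covariance
-- matrix, with 1/6 = 10/60.
record Kernel (n : ℕ) : Set where
  field
    κ          : Fin n → Fin n → ℚ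
    κ-sym      : ∀ k l → κ k l ≡ κ l k
    κ-nonneg   : ∀ k l → 0ℚ ≤ κ k l
    κ-≤1       : ∀ k l → κ k l ≤ 1ℚ
    κ-diag     : ∀ k → κ k k ≡ 1ℚ
    κ-row      : ∀ k → sum (κ k) ≡ + 10 / 1
    κ-centered : ∀ w → (+ 1 / 6) * (sum w * sum w) ≤ Form κ w w

-- Used twice: for the quadratic form, where z is a product of two vector entries, and for the total
-- mass, where z is one.
weight-expand : ∀ a b q U V m z → weight a b q U V m * z ≡
  (+ 1 / 60) * ((a * (b * z)
    + ((+ 1 / 9) * (((1ℚ - a) * (1ℚ - b)) * (q * (U * z)))
     + (+ 1 / 2450) * (((1ℚ - a) * (1ℚ - b)) * (((+ 40 / 1) + (+ 10 / 1) * q) * (V * z)))))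
    + (+ 1 / 50) * ((1ℚ + (- 1ℚ) * q) * (m * z)))
weight-expand a b q U V m z = expand a b ((1ℚ - a) * (1ℚ - b)) q ((+ 40 / 1) + (+ 10 / 1) * q) (1ℚ + (- 1ℚ) * q)
  where
  expand : ∀ a b c q q′ q̄ →
    ((+ 1 / 60) * ((a * b + c * ((+ 1 / 9) * (q * U) + (+ 1 / 2450) * (q′ * V))) + (+ 1 / 50) * (q̄ * m))) * z
      ≡ (+ 1 / 60) * ((a * (b * z) + ((+ 1 / 9) * (c * (q * (U * z))) + (+ 1 / 2450) * (c * (q′ * (V * z)))))
          + (+ 1 / 50) * (q̄ * (m * z)))
  expand a b c q q′ q̄ = solve 10 (λ a b c q q′ q̄ U V m z →
    (con (+ 1 / 60) :* ((a :* b :+ c :* (con (+ 1 / 9) :* (q :* U) :+ con (+ 1 / 2450) :* (q′ :* V)))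
      :+ con (+ 1 / 50) :* (q̄ :* m))) :* z
      := con (+ 1 / 60) :* ((a :* (b :* z)
        :+ (con (+ 1 / 9) :* (c :* (q :* (U :* z))) :+ con (+ 1 / 2450) :* (c :* (q′ :* (V :* z)))))
        :+ con (+ 1 / 50) :* (q̄ :* (m :* z))))
    refl a b c q q′ q̄ U V m z

-- The summands on the right are Laplacian terms of the two parts, the spectral
-- gap of κ and a square.
form-as-squares : ∀ a b qU qUV qV sU sV gP gQ tP tQ →
  ((tP + tQ) + ((+ 1 / 9) * (((qU - gP) - 1ℚ * sU) + 1ℚ * tP)
      + (+ 1 / 2450) * (((((+ 40 / 1) * (b * b) + (+ 10 / 1) * qV) - gQ) - (+ 50 / 1) * sV) + (+ 50 / 1) * tQ)))
    + (+ 1 / 50) * ((1ℚ * (a * b) + (- 1ℚ) * qUV) + (1ℚ * (a * b) + (- 1ℚ) * qUV))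
  ≡ ((+ 1 / 90) * ((+ 10 / 1) * ((+ 10 / 1) * tP - gP) - ((+ 10 / 1) * sU - qU))
      + (+ 1 / 122500) * ((+ 50 / 1) * ((+ 2500 / 1) * tQ - gQ)
          - ((+ 2500 / 1) * sV - ((+ 40 / 1) * (b * b) + (+ 10 / 1) * qV))))
    + ((+ 1 / 10) * (((qU + ((- (+ 1 / 5)) + (- (+ 1 / 5))) * qUV) + ((- (+ 1 / 5)) * (- (+ 1 / 5))) * qV)
          - (+ 1 / 6) * ((a + (- (+ 1 / 5)) * b) * (a + (- (+ 1 / 5)) * b)))
      + (+ 1 / 60) * ((a + b) * (a + b)))
form-as-squares = solve 11 (λ a b qU qUV qV sU sV gP gQ tP tQ →
  ((tP :+ tQ) :+ (con (+ 1 / 9) :* (((qU :- gP) :- con 1ℚ :* sU) :+ con 1ℚ :* tP)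
      :+ con (+ 1 / 2450)
        :* ((((con (+ 40 / 1) :* (b :* b) :+ con (+ 10 / 1) :* qV) :- gQ) :- con (+ 50 / 1) :* sV) :+ con (+ 50 / 1) :* tQ)))
    :+ con (+ 1 / 50) :* ((con 1ℚ :* (a :* b) :+ con (- 1ℚ) :* qUV) :+ (con 1ℚ :* (a :* b) :+ con (- 1ℚ) :* qUV))
  := (con (+ 1 / 90) :* (con (+ 10 / 1) :* (con (+ 10 / 1) :* tP :- gP) :- (con (+ 10 / 1) :* sU :- qU))
      :+ con (+ 1 / 122500) :* (con (+ 50 / 1) :* (con (+ 2500 / 1) :* tQ :- gQ)
          :- (con (+ 2500 / 1) :* sV :- (con (+ 40 / 1) :* (b :* b) :+ con (+ 10 / 1) :* qV))))
    :+ (con (+ 1 / 10) :* (((qU :+ (con (- (+ 1 / 5)) :+ con (- (+ 1 / 5))) :* qUV)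
            :+ (con (- (+ 1 / 5)) :* con (- (+ 1 / 5))) :* qV)
          :- con (+ 1 / 6) :* ((a :+ con (- (+ 1 / 5)) :* b) :* (a :+ con (- (+ 1 / 5)) :* b)))
      :+ con (+ 1 / 60) :* ((a :+ b) :* (a :+ b)))) refl

-- Tours in a cut metric

cutMetric : ∀ {N} → (Fin N → Bool) → Matrix N N
cutMetric g i j = 𝟙 (g i xor g j)

cutMetric-isTSPInstance : ∀ {N} (g : Fin N → Bool) → IsTSPInstance (cutMetric g)
cutMetric-isTSPInstance g = record
  { symmetric = λ i j → symmetric (g i) (g j)
  ; nonneg    = λ i j → nonneg (g i xor g j)
  ; diagonal  = λ i → diagonal (g i)
  ; triangle  = λ i j k → triangle (g i) (g j) (g k)
  }
  where
  symmetric : ∀ a b → 𝟙 (a xor b) ≈ 𝟙 (b xor a)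
  symmetric true  true  = ≈-pointwise λ _ → refl
  symmetric true  false = ≈-pointwise λ _ → refl
  symmetric false true  = ≈-pointwise λ _ → refl
  symmetric false false = ≈-pointwise λ _ → refl
  nonneg : ∀ b → 0ℝ ≤ʳ 𝟙 b
  nonneg true  = ≤-pointwise λ _ → ℚ.nonNegative⁻¹ 1ℚ
  nonneg false = ≤-pointwise λ _ → ℚ.≤-refl
  diagonal : ∀ a → 𝟙 (a xor a) ≈ 0ℝ
  diagonal true  = ≈-pointwise λ _ → refl
  diagonal false = ≈-pointwise λ _ → refl
  triangle : ∀ a b c → 𝟙 (a xor b) ≤ʳ 𝟙 (a xor c) +ʳ 𝟙 (c xor b)
  triangle true  true  true  = ≤-pointwise λ _ → ℚ.≤-refl
  triangle true  true  false = ≤-pointwise λ _ → ℚ.nonNegative⁻¹ (+ 2 / 1)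
  triangle true  false true  = ≤-pointwise λ _ → ℚ.≤-refl
  triangle true  false false = ≤-pointwise λ _ → ℚ.≤-refl
  triangle false true  true  = ≤-pointwise λ _ → ℚ.≤-refl
  triangle false true  false = ≤-pointwise λ _ → ℚ.≤-refl
  triangle false false true  = ≤-pointwise λ _ → ℚ.nonNegative⁻¹ (+ 2 / 1)
  triangle false false false = ≤-pointwise λ _ → ℚ.≤-refl

next-mod : ∀ {n} j → next (j mod suc n) ≡ suc j mod suc n
next-mod {n} j = toℕ-injective (begin
  toℕ (next (j mod suc n))
    ≡⟨ toℕ-fromℕ< (m%n<n (suc (toℕ (j mod suc n))) (suc n)) ⟩
  suc (toℕ (j mod suc n)) % suc n
    ≡⟨ cong (λ x → suc x % suc n) (toℕ-fromℕ< (m%n<n j (suc n))) ⟩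
  (1 ℕ.+ j % suc n) % suc n
    ≡⟨ %-distribˡ-+ 1 (j % suc n) (suc n) ⟩
  (1 % suc n ℕ.+ j % suc n % suc n) % suc n
    ≡⟨ cong (λ x → (1 % suc n ℕ.+ x) % suc n) (m%n%n≡m%n j (suc n)) ⟩
  (1 % suc n ℕ.+ j % suc n) % suc n
    ≡⟨ %-distribˡ-+ 1 j (suc n) ⟨
  suc j % suc n
    ≡⟨ toℕ-fromℕ< (m%n<n (suc j) (suc n)) ⟨
  toℕ (suc j mod suc n) ∎)
  where open ≡-Reasoning

toℕ-mod : ∀ {n} (i : Fin (suc n)) → toℕ i mod suc n ≡ i
toℕ-mod {n} i = toℕ-injective (trans (toℕ-fromℕ< (m%n<n (toℕ i) (suc n))) (m<n⇒m%n≡m (toℕ<n i)))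

mod-periodic : ∀ {n} j → (j ℕ.+ suc n) mod suc n ≡ j mod suc n
mod-periodic {n} j = toℕ-injective (trans (toℕ-fromℕ< (m%n<n (j ℕ.+ suc n) (suc n)))
  (trans ([m+n]%n≡m%n j (suc n)) (sym (toℕ-fromℕ< (m%n<n j (suc n))))))

first-drop : (f : ℕ → Bool) → ∀ d j → f j ≡ true → f (d ℕ.+ j) ≡ false →
             ∃[ i ] (f i ≡ true × f (suc i) ≡ false)
first-drop f zero    j fj≡t fj≡f = contradiction (trans (sym fj≡t) fj≡f) λ ()
first-drop f (suc d) j fj≡t fd≡f with f (suc j) in eq
... | false = j , fj≡t , eq
... | true  = first-drop f d (suc j) eq (trans (cong f (ℕ.+-suc d j)) fd≡f)

cyclic-drop : ∀ {n} (f : Fin (suc n) → Bool) a b → f a ≡ true → f b ≡ false →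
              ∃[ i ] (f i ≡ true × f (next i) ≡ false)
cyclic-drop {n} f a b fa fb with first-drop (λ j → f (j mod suc n)) d (toℕ a) (trans (cong f (toℕ-mod a)) fa) end
  where
  -- One extra turn around the cycle puts b beyond a in either order, so the subtraction does not
  -- truncate.
  d : ℕ
  d = (toℕ b ℕ.+ suc n) ℕ.∸ toℕ a
  end : f ((d ℕ.+ toℕ a) mod suc n) ≡ false
  end = trans (cong (λ x → f (x mod suc n)) (ℕ.m∸n+n≡m (ℕ.≤-trans (ℕ.<⇒≤ (toℕ<n a)) (ℕ.m≤n+m (suc n) (toℕ b)))))
    (trans (cong f (trans (mod-periodic (toℕ b)) (toℕ-mod b))) fb)
... | j , fj , fsj = j mod suc n , fj , trans (cong f (next-mod j)) fsj

two≤sum : ∀ {n} {f : Fin n → ℚ} i j → i ≢ j → (∀ k → 0ℚ ≤ f k) → f i ≡ 1ℚ → f j ≡ 1ℚ → + 2 / 1 ≤ sum f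
two≤sum {f = f} i j i≢j f≥0 fi fj = subst (_≤ sum f)
  (trans (sum-+ (δ i) (δ j)) (cong₂ _+_ (sum-δ-one i) (sum-δ-one j))) (sum-mono bound)
  where
  sum-δ-one : ∀ i → sum (δ i) ≡ 1ℚ
  sum-δ-one i = trans (sum-cong λ k → sym (ℚ.*-identityʳ (δ i k))) (sum-δ i (const 1ℚ))
  bound : ∀ k → δ i k + δ j k ≤ f k
  bound k with δ-cases i k | δ-cases j k
  ... | inj₁ p | inj₁ q rewrite p | q = f≥0 k
  ... | inj₁ p | inj₂ (refl , q) rewrite p | q = ℚ.≤-reflexive (sym fj)
  ... | inj₂ (refl , p) | inj₁ q rewrite p | q = ℚ.≤-reflexive (sym fi)
  ... | inj₂ (refl , _) | inj₂ (refl , _) = contradiction refl i≢j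

-- A tour must leave the part and return to it. The exit is a cyclic drop of `g` along the tour and
-- the entry a drop of its negation; the two edges differ because `g` differs at their starting
-- points.
tourCost≥2 : ∀ {n} (g : Fin (suc n) → Bool) a b → g a ≡ true → g b ≡ false →
             ∀ σ → 2ℝ ≤ʳ tourCost (cutMetric g) σ
tourCost≥2 {n} g a b ga gb σ
  with cyclic-drop (g ∘ (σ ⟨$⟩ʳ_)) (σ ⟨$⟩ˡ a) (σ ⟨$⟩ˡ b)
         (trans (cong g (inverseʳ σ)) ga) (trans (cong g (inverseʳ σ)) gb)
     | cyclic-drop (not ∘ g ∘ (σ ⟨$⟩ʳ_)) (σ ⟨$⟩ˡ b) (σ ⟨$⟩ˡ a)
         (cong not (trans (cong g (inverseʳ σ)) gb)) (cong not (trans (cong g (inverseʳ σ)) ga))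
... | i , gi , gi⁺ | j , gj , gj⁺ = ≤-pointwise λ N → subst (+ 2 / 1 ≤_)
  (sym (trans (seq-sum (λ k → cutMetric g (σ ⟨$⟩ʳ k) (σ ⟨$⟩ʳ next k)) N) (sum-cong λ k → seq-𝟙 (step k) N)))
  (two≤sum i j i≢j (λ k → indicator-nonneg (step k))
    (cong indicator (cong₂ _xor_ gi gi⁺)) (rise (g (σ ⟨$⟩ʳ j)) (g (σ ⟨$⟩ʳ next j)) gj gj⁺))
  where
  step : Fin (suc n) → Bool
  step k = g (σ ⟨$⟩ʳ k) xor g (σ ⟨$⟩ʳ next k)
  i≢j : i ≢ j
  i≢j refl = contradiction (trans (sym (cong not gi)) gj) λ ()
  rise : ∀ x y → not x ≡ true → not y ≡ false → indicator (x xor y) ≡ 1ℚ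
  rise false true refl refl = refl

-- City s joins the large part.
extend : ∀ {n} → Fin (suc n) → (Fin n → Bool) → Fin (suc n) → Bool
extend s side t with s ≟ t
... | yes _  = false
... | no s≢t = side (punchOut s≢t)

extend-self : ∀ {n} (s : Fin (suc n)) side → extend s side s ≡ false
extend-self s side with s ≟ s
... | yes _  = refl
... | no s≢s = contradiction refl s≢s

extend-punchIn : ∀ {n} (s : Fin (suc n)) side i → extend s side (punchIn s i) ≡ side i
extend-punchIn s side i with s ≟ punchIn s i
... | yes s≡i = contradiction (sym s≡i) (punchInᵢ≢i s i)
... | no s≢i = cong side (trans (punchOut-cong s refl) (punchOut-punchIn s))

-- If m = 1 the two cities lie in different parts, which leaves only the last summand.
weight-mixed : ∀ {a m U V} b q → m ≡ 0ℚ ⊎ (m ≡ 1ℚ × a ≡ 0ℚ × U ≡ 0ℚ × V ≡ 0ℚ) →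
               m * weight a b q U V m ≡ (+ 1 / 3000) * (m * (1ℚ + (- 1ℚ) * q))
weight-mixed {a} {U = U} {V} b q (inj₁ refl) = trans (ℚ.*-zeroˡ (weight a b q U V 0ℚ))
  (sym (trans (cong ((+ 1 / 3000) *_) (ℚ.*-zeroˡ (1ℚ + (- 1ℚ) * q))) (ℚ.*-zeroʳ (+ 1 / 3000))))
weight-mixed b q (inj₂ (refl , refl , refl , refl)) = solve 2 (λ b q →
  con 1ℚ :* weightᴾ (con 0ℚ) b q (con 0ℚ) (con 0ℚ) (con 1ℚ)
    := con (+ 1 / 3000) :* (con 1ℚ :* (con 1ℚ :+ con (- 1ℚ) :* q))) refl b q

δ-pairs : ∀ {m n} (a b : Fin (m ℕ.* n)) →
          δ a b ≡ δ (quotient {m} n a) (quotient n b) * δ (remainder {m} n a) (remainder {m} n b)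
δ-pairs {m} {n} a b with δ-cases a b
... | inj₂ (refl , δ≡1) = trans δ≡1 (sym (cong₂ _*_ (δ-refl (quotient {m} n a)) (δ-refl (remainder {m} n a))))
... | inj₁ δ≡0 with δ-cases (quotient {m} n a) (quotient n b) | δ-cases (remainder {m} n a) (remainder {m} n b)
...   | inj₁ p | _ = trans δ≡0 (sym (trans (cong (_* δ (remainder {m} n a) (remainder {m} n b)) p)
                       (ℚ.*-zeroˡ (δ (remainder {m} n a) (remainder {m} n b)))))
...   | inj₂ _ | inj₁ p = trans δ≡0 (sym (trans (cong (δ (quotient {m} n a) (quotient n b) *_) p)
                            (ℚ.*-zeroʳ (δ (quotient {m} n a) (quotient n b)))))
...   | inj₂ (p , _) | inj₂ (q , _) = contradiction
  (trans (sym δ≡0) (trans (cong (λ c → δ c b) a≡b) (δ-refl b))) λ ()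
  where
  a≡b : a ≡ b
  a≡b = trans (sym (combine-remQuot {m} n a)) (trans (cong₂ combine p q) (combine-remQuot {m} n b))

adjacent : ∀ {n} → Fin (suc n) → Fin (suc n) → Bool
adjacent a b = ⌊ b ≟ next a ⌋ ∨ ⌊ a ≟ next b ⌋

-- The relaxed solution for a part of ten cities and a given kernel

-- n stays a variable: at the literal 60 the sums in Defs over n * n indices would
-- unfold.
module Relaxation (n : ℕ) (n≡60 : n ≡ 60) (side : Fin n → Bool)
  (side-count : sum (indicator ∘ side) ≡ + 10 / 1) (kernel : Kernel n) where

  open Kernel kernel

  u v : Fin n → ℚ
  u i = indicator (side i)
  v i = indicator (not (side i))

  sum-ones : ∀ q → sum {n} (const q) ≡ (+ 60 / 1) * q
  sum-ones q = trans (sum-const n q) (cong (λ m → (m ⋆ 1ℚ) * q) n≡60)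

  u+v : ∀ i → u i + v i ≡ 1ℚ
  u+v i with side i
  ... | true  = refl
  ... | false = refl

  uv : ∀ i → u i * v i ≡ 0ℚ
  uv i with side i
  ... | true  = refl
  ... | false = refl

  uu : ∀ i → u i * u i ≡ u i
  uu i with side i
  ... | true  = refl
  ... | false = refl

  vv : ∀ i → v i * v i ≡ v i
  vv i with side i
  ... | true  = refl
  ... | false = refl

  sum-u : sum u ≡ + 10 / 1
  sum-u = side-count

  sum-v : sum v ≡ + 50 / 1
  sum-v = trans (solve 2 (λ a b → b := (a :+ b) :+ con (- 1ℚ) :* a) refl (sum u) (sum v))
    (cong₂ (λ t a → t + (- 1ℚ) * a) (trans (sym (sum-+ u v)) (trans (sum-cong u+v) (sum-ones 1ℚ))) sum-u)

  -- The other two pair probabilities, rescaled: `κ′` is 60 (4 + κ) / 6, for both positions in the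
  -- large part, and `κ̄` is three times the probability that the positions are separated. Divided
  -- by 50, `κ′` has unit diagonal and row sum 50, just as `κ` has unit diagonal and row sum 10.
  κ′ κ̄ : Fin n → Fin n → ℚ
  κ′ = affine (+ 40 / 1) (+ 10 / 1) κ
  κ̄ = affine 1ℚ (- 1ℚ) κ

  κ′-sym : ∀ k l → κ′ k l ≡ κ′ l k
  κ′-sym k l = cong (λ q → (+ 40 / 1) + (+ 10 / 1) * q) (κ-sym k l)

  κ̄-sym : ∀ k l → κ̄ k l ≡ κ̄ l k
  κ̄-sym k l = cong (λ q → 1ℚ + (- 1ℚ) * q) (κ-sym k l)

  κ′-nonneg : ∀ k l → 0ℚ ≤ κ′ k l
  κ′-nonneg k l = +-nonneg (ℚ.nonNegative⁻¹ (+ 40 / 1)) (*-nonneg (ℚ.nonNegative⁻¹ (+ 10 / 1)) (κ-nonneg k l))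

  κ̄-nonneg : ∀ k l → 0ℚ ≤ κ̄ k l
  κ̄-nonneg k l = subst (0ℚ ≤_) (solve 1 (λ q → con 1ℚ :- q := con 1ℚ :+ con (- 1ℚ) :* q) refl (κ k l))
    (≤⇒diff-nonneg (κ-≤1 k l))

  κ′-diag : ∀ k → κ′ k k ≡ + 50 / 1
  κ′-diag k = cong (λ q → (+ 40 / 1) + (+ 10 / 1) * q) (κ-diag k)

  affine-row : ∀ a b k → sum (affine a b κ k) ≡ (+ 60 / 1) * a + b * (+ 10 / 1)
  affine-row a b k = trans (sum-+ (const a) (λ l → b * κ k l))
    (cong₂ _+_ (sum-ones a) (trans (sum-*ˡ b (κ k)) (cong (b *_) (κ-row k))))

  mixed : Fin n → Fin n → ℚ
  mixed i j = u i * v j + v i * u j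

  -- City i at position k together with city j at position l. Cities come first because the
  -- distances form the left factor of the Kronecker product in the cost.
  y : Fin n → Fin n → Fin n → Fin n → ℚ
  y i k j l = weight (δ i j) (δ k l) (κ k l) (u i * u j) (v i * v j) (mixed i j)

  mixed-sym : ∀ i j → mixed i j ≡ mixed j i
  mixed-sym i j = trans (ℚ.+-comm (u i * v j) (v i * u j))
    (cong₂ _+_ (ℚ.*-comm (v i) (u j)) (ℚ.*-comm (u i) (v j)))

  y-sym : ∀ i k j l → y i k j l ≡ y j l i k
  y-sym i k j l = trans
    (cong₂ (λ a b → weight a b (κ k l) (u i * u j) (v i * v j) (mixed i j)) (δ-sym i j) (δ-sym k l))
    (trans (cong₂ (λ q m → weight (δ j i) (δ l k) q (u i * u j) (v i * v j) m) (κ-sym k l) (mixed-sym i j))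
      (cong₂ (λ U V → weight (δ j i) (δ l k) (κ l k) U V (mixed j i)) (ℚ.*-comm (u i) (u j)) (ℚ.*-comm (v i) (v j))))

  y-nonneg : ∀ i k j l → 0ℚ ≤ y i k j l
  y-nonneg i k j l = *-nonneg (ℚ.nonNegative⁻¹ (+ 1 / 60)) (+-nonneg (+-nonneg
      (*-nonneg (δ≥0 i j) (δ≥0 k l))
      (*-nonneg (*-nonneg (1-δ≥0 i j) (1-δ≥0 k l))
        (+-nonneg (*-nonneg (ℚ.nonNegative⁻¹ (+ 1 / 9)) (*-nonneg (κ-nonneg k l) (*-nonneg (u≥0 i) (u≥0 j))))
                  (*-nonneg (ℚ.nonNegative⁻¹ (+ 1 / 2450)) (*-nonneg (κ′-nonneg k l) (*-nonneg (v≥0 i) (v≥0 j)))))))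
    (*-nonneg (ℚ.nonNegative⁻¹ (+ 1 / 50)) (*-nonneg (κ̄-nonneg k l)
      (+-nonneg (*-nonneg (u≥0 i) (v≥0 j)) (*-nonneg (v≥0 i) (u≥0 j))))))
    where
    δ≥0 : (i j : Fin n) → 0ℚ ≤ δ i j
    δ≥0 i j = indicator-nonneg ⌊ i ≟ j ⌋
    1-δ≥0 : (i j : Fin n) → 0ℚ ≤ 1ℚ - δ i j
    1-δ≥0 i j = ≤⇒diff-nonneg (indicator-≤1 ⌊ i ≟ j ⌋)
    u≥0 v≥0 : ∀ i → 0ℚ ≤ _
    u≥0 i = indicator-nonneg (side i)
    v≥0 i = indicator-nonneg (not (side i))

  mixed-diag : ∀ i → mixed i i ≡ 0ℚ
  mixed-diag i = cong₂ _+_ (uv i) (trans (ℚ.*-comm (v i) (u i)) (uv i))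

  y-diag : ∀ i k → y i k i k ≡ + 1 / 60
  y-diag i k = trans (cong₂ (λ a b → weight a b (κ k k) (u i * u i) (v i * v i) (mixed i i)) (δ-refl i) (δ-refl k))
    (trans (cong (λ q → weight 1ℚ 1ℚ q (u i * u i) (v i * v i) (mixed i i)) (κ-diag k))
      (weight-diag (u i * u i) (v i * v i) (mixed i i)))

  y-same-city : ∀ i k j l → (δ i j * (1ℚ - δ k l)) * y i k j l ≡ 0ℚ
  y-same-city i k j l = weight-same-city {δ i j} {δ k l} {mixed i j} (κ k l) (u i * u j) (v i * v j)
    (map₂ (λ { (refl , δ≡1) → δ≡1 , mixed-diag i }) (δ-cases i j)) (map₂ proj₂ (δ-cases k l))

  y-same-position : ∀ i k j l → ((1ℚ - δ i j) * δ k l) * y i k j l ≡ 0ℚ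
  y-same-position i k j l = weight-same-position {δ i j} {δ k l} {κ k l} (u i * u j) (v i * v j) (mixed i j)
    (map₂ proj₂ (δ-cases i j)) (map₂ (λ { (refl , δ≡1) → δ≡1 , κ-diag k }) (δ-cases k l))

  -- Positive semidefiniteness

  module _ (x : Fin n → Fin n → ℚ) where

    private
      P Q : Fin n → Fin n → ℚ
      P i k = u i * x i k
      Q i k = v i * x i k

      U V w : Fin n → ℚ
      U = colSum P
      V = colSum Q
      -- The ratio 10/50 makes `w` vanish whenever x does not depend on the city. This is forced:
      -- such an x with zero total has to be a null vector, as every position holds exactly one
      -- city.
      w k = U k + (- (+ 1 / 5)) * V k

      a b tP tQ gP gQ : ℚ
      a = sum U
      b = sum V
      tP = sum (λ i → sqNorm (P i))
      tQ = sum (λ i → sqNorm (Q i))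
      gP = sum (λ i → Form κ (P i) (P i))
      gQ = sum (λ i → Form κ′ (Q i) (Q i))

      f₁ f₂ f₃ f₄ f₅ : Fin n → Fin n → Fin n → Fin n → ℚ
      f₁ i k j l = δ i j * (δ k l * (x i k * x j l))
      f₂ i k j l = ((1ℚ - δ i j) * (1ℚ - δ k l)) * (κ k l * (P i k * P j l))
      f₃ i k j l = ((1ℚ - δ i j) * (1ℚ - δ k l)) * (κ′ k l * (Q i k * Q j l))
      f₄ i k j l = κ̄ k l * (P i k * Q j l)
      f₅ i k j l = κ̄ k l * (Q i k * P j l)

      interchange : ∀ a b c d → (a * b) * (c * d) ≡ (a * c) * (b * d)
      interchange = solve 4 (λ a b c d → (a :* b) :* (c :* d) := (a :* c) :* (b :* d)) refl

      -- The masks `u` and `v` move from the weight onto x, so that, apart from the exclusion of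
      -- equal indices, the kernels left behind depend on the positions alone.
      expand : ∀ i k j l → x i k * y i k j l * x j l ≡
        (+ 1 / 60) * ((f₁ i k j l + ((+ 1 / 9) * f₂ i k j l + (+ 1 / 2450) * f₃ i k j l))
                      + (+ 1 / 50) * (f₄ i k j l + f₅ i k j l))
      expand i k j l = begin
        x i k * y i k j l * x j l
          ≡⟨ solve 3 (λ x w x′ → x :* w :* x′ := w :* (x :* x′)) refl (x i k) (y i k j l) (x j l) ⟩
        y i k j l * (x i k * x j l)
          ≡⟨ weight-expand (δ i j) (δ k l) (κ k l) (u i * u j) (v i * v j) (mixed i j) (x i k * x j l) ⟩
        (+ 1 / 60) * ((f₁ i k j l
          + ((+ 1 / 9) * (c * (κ k l * ((u i * u j) * z))) + (+ 1 / 2450) * (c * (κ′ k l * ((v i * v j) * z)))))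
          + (+ 1 / 50) * (κ̄ k l * (mixed i j * z)))
          ≡⟨ cong₂ (λ s t → (+ 1 / 60) * ((f₁ i k j l + s) + (+ 1 / 50) * t))
               (cong₂ (λ p q → (+ 1 / 9) * (c * (κ k l * p)) + (+ 1 / 2450) * (c * (κ′ k l * q)))
                 (interchange (u i) (u j) (x i k) (x j l)) (interchange (v i) (v j) (x i k) (x j l)))
               (trans (cong (κ̄ k l *_) (trans (ℚ.*-distribʳ-+ z (u i * v j) (v i * u j))
                        (cong₂ _+_ (interchange (u i) (v j) (x i k) (x j l)) (interchange (v i) (u j) (x i k) (x j l)))))
                      (ℚ.*-distribˡ-+ (κ̄ k l) (P i k * Q j l) (Q i k * P j l))) ⟩
        (+ 1 / 60) * ((f₁ i k j l + ((+ 1 / 9) * f₂ i k j l + (+ 1 / 2450) * f₃ i k j l))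
                      + (+ 1 / 50) * (f₄ i k j l + f₅ i k j l)) ∎
        where
        open ≡-Reasoning
        c z : ℚ
        c = (1ℚ - δ i j) * (1ℚ - δ k l)
        z = x i k * x j l

      split-square : ∀ i k → x i k * x i k ≡ P i k * P i k + Q i k * Q i k
      split-square i k = sym (begin
        P i k * P i k + Q i k * Q i k
          ≡⟨ solve 3 (λ u v x → (u :* x) :* (u :* x) :+ (v :* x) :* (v :* x) := (u :* u :+ v :* v) :* (x :* x))
               refl (u i) (v i) (x i k) ⟩
        (u i * u i + v i * v i) * (x i k * x i k)
          ≡⟨ cong (_* (x i k * x i k)) (trans (cong₂ _+_ (uu i) (vv i)) (u+v i)) ⟩
        1ℚ * (x i k * x i k)
          ≡⟨ ℚ.*-identityˡ (x i k * x i k) ⟩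
        x i k * x i k ∎)
        where open ≡-Reasoning

      total : ∑⁴ (λ i k j l → x i k * y i k j l * x j l) ≡
        (+ 1 / 60) * ((∑⁴ f₁ + ((+ 1 / 9) * ∑⁴ f₂ + (+ 1 / 2450) * ∑⁴ f₃)) + (+ 1 / 50) * (∑⁴ f₄ + ∑⁴ f₅))
      total = begin
        ∑⁴ (λ i k j l → x i k * y i k j l * x j l)
          ≡⟨ ∑⁴-cong expand ⟩
        ∑⁴ (λ i k j l → (+ 1 / 60) * (g₁ i k j l + g₂ i k j l))
          ≡⟨ ∑⁴-*ˡ (+ 1 / 60) (λ i k j l → g₁ i k j l + g₂ i k j l) ⟩
        (+ 1 / 60) * ∑⁴ (λ i k j l → g₁ i k j l + g₂ i k j l)
          ≡⟨ cong ((+ 1 / 60) *_) (trans (∑⁴-+ g₁ g₂) (cong₂ _+_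
               (trans (∑⁴-+ f₁ g₃) (cong (λ s → ∑⁴ f₁ + s)
                 (trans (∑⁴-+ (λ i k j l → (+ 1 / 9) * f₂ i k j l) (λ i k j l → (+ 1 / 2450) * f₃ i k j l))
                   (cong₂ _+_ (∑⁴-*ˡ (+ 1 / 9) f₂) (∑⁴-*ˡ (+ 1 / 2450) f₃)))))
               (trans (∑⁴-*ˡ (+ 1 / 50) (λ i k j l → f₄ i k j l + f₅ i k j l)) (cong ((+ 1 / 50) *_) (∑⁴-+ f₄ f₅))))) ⟩
        (+ 1 / 60) * ((∑⁴ f₁ + ((+ 1 / 9) * ∑⁴ f₂ + (+ 1 / 2450) * ∑⁴ f₃)) + (+ 1 / 50) * (∑⁴ f₄ + ∑⁴ f₅)) ∎
        where
        open ≡-Reasoning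
        g₁ g₂ g₃ : Fin n → Fin n → Fin n → Fin n → ℚ
        g₃ i k j l = (+ 1 / 9) * f₂ i k j l + (+ 1 / 2450) * f₃ i k j l
        g₁ i k j l = f₁ i k j l + g₃ i k j l
        g₂ i k j l = (+ 1 / 50) * (f₄ i k j l + f₅ i k j l)

      ∑f₁ : ∑⁴ f₁ ≡ tP + tQ
      ∑f₁ = trans (∑⁴-δδ (λ i k j l → x i k * x j l)) (trans (∑∑-cong split-square)
        (trans (sum-cong λ i → sum-+ (λ k → P i k * P i k) (λ k → Q i k * Q i k))
          (sum-+ (λ i → sqNorm (P i)) (λ i → sqNorm (Q i)))))

      -- With the cities summed out, eleven numbers determine the form: totals, kernel forms and
      -- norms of `U` and `V`, and the four sums over single cities that the block diagonals leave.
      -- The rest is a polynomial identity in these numbers.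
      squares : (+ 60 / 1) * ∑⁴ (λ i k j l → x i k * y i k j l * x j l) ≡
        ((+ 1 / 90) * ((+ 10 / 1) * ((+ 10 / 1) * tP - gP) - laplacian κ (+ 10 / 1) U)
          + (+ 1 / 122500) * ((+ 50 / 1) * ((+ 2500 / 1) * tQ - gQ)
              - ((+ 2500 / 1) * sqNorm V - ((+ 40 / 1) * (b * b) + (+ 10 / 1) * Form κ V V))))
        + ((+ 1 / 10) * (((Form κ U U + ((- (+ 1 / 5)) + (- (+ 1 / 5))) * Form κ U V)
                            + ((- (+ 1 / 5)) * (- (+ 1 / 5))) * Form κ V V)
              - (+ 1 / 6) * ((a + (- (+ 1 / 5)) * b) * (a + (- (+ 1 / 5)) * b)))
          + (+ 1 / 60) * ((a + b) * (a + b)))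
      squares = trans (trans (cong ((+ 60 / 1) *_) (trans total (cong (λ s → (+ 1 / 60) * s)
        (cong₂ (λ s t → s + (+ 1 / 50) * t)
          (cong₂ _+_ ∑f₁ (cong₂ (λ s t → (+ 1 / 9) * s + (+ 1 / 2450) * t)
            (∑⁴-offDiagonal κ 1ℚ P κ-diag)
            (trans (∑⁴-offDiagonal κ′ (+ 50 / 1) Q κ′-diag)
              (cong (λ s → ((s - gQ) - (+ 50 / 1) * sqNorm V) + (+ 50 / 1) * tQ)
                (Form-affine (+ 40 / 1) (+ 10 / 1) κ V V)))))
          (cong₂ _+_ (trans (∑⁴-Form κ̄ P Q) (Form-affine 1ℚ (- 1ℚ) κ U V))
            (trans (∑⁴-Form κ̄ Q P) (trans (Form-sym κ̄-sym V U) (Form-affine 1ℚ (- 1ℚ) κ U V))))))))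
          (cancel60 _))
        (form-as-squares a b (Form κ U U) (Form κ U V) (Form κ V V) (sqNorm U) (sqNorm V) gP gQ tP tQ)
        where
        cancel60 : ∀ q → (+ 60 / 1) * ((+ 1 / 60) * q) ≡ q
        cancel60 = solve 1 (λ q → con (+ 60 / 1) :* (con (+ 1 / 60) :* q) := q) refl

      |u|² : sqNorm u ≡ + 10 / 1
      |u|² = trans (sum-cong uu) sum-u

      |v|² : sqNorm v ≡ + 50 / 1
      |v|² = trans (sum-cong vv) sum-v

      sum-laplacian : ∀ K R (Z : Fin n → Fin n → ℚ) →
        sum (λ i → laplacian K R (Z i)) ≡ R * sum (λ i → sqNorm (Z i)) - sum (λ i → Form K (Z i) (Z i))
      sum-laplacian K R Z = trans
        (sum-cong λ i → solve 2 (λ a b → a :- b := a :+ con (- 1ℚ) :* b) refl (R * sqNorm (Z i)) (Form K (Z i) (Z i)))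
        (trans (sum-+ (λ i → R * sqNorm (Z i)) (λ i → (- 1ℚ) * Form K (Z i) (Z i)))
          (trans (cong₂ _+_ (sum-*ˡ R (λ i → sqNorm (Z i))) (sum-*ˡ (- 1ℚ) (λ i → Form K (Z i) (Z i))))
            (solve 2 (λ a b → a :+ con (- 1ℚ) :* b := a :- b)
              refl (R * sum (λ i → sqNorm (Z i))) (sum (λ i → Form K (Z i) (Z i))))))

      masked : ∀ (f : Fin n → ℚ) → (∀ i → f i * f i ≡ f i) → ∀ i k → f i * (f i * x i k) ≡ f i * x i k
      masked f ff i k = trans (sym (ℚ.*-assoc (f i) (f i) (x i k))) (cong (_* x i k) (ff i))

      -- The number 10 plays two roles: the outer factor is the number of cities of the part, the
      -- inner one the row sum of `κ`. In `Q-bound` the two separate into 50 cities and the row sum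
      -- 2500 = 60 · 40 + 10 · 10 of `κ′`.
      P-bound : 0ℚ ≤ (+ 10 / 1) * ((+ 10 / 1) * tP - gP) - laplacian κ (+ 10 / 1) U
      P-bound = subst (λ s → 0ℚ ≤ (+ 10 / 1) * s - laplacian κ (+ 10 / 1) U) (sum-laplacian κ (+ 10 / 1) P)
        (≤⇒diff-nonneg (laplacian-colSum κ (+ 10 / 1) κ-sym κ-row κ-nonneg u (+ 10 / 1) |u|² P (masked u uu)))

      Q-bound : 0ℚ ≤ (+ 50 / 1) * ((+ 2500 / 1) * tQ - gQ)
                       - ((+ 2500 / 1) * sqNorm V - ((+ 40 / 1) * (b * b) + (+ 10 / 1) * Form κ V V))
      Q-bound = subst (λ s → 0ℚ ≤ (+ 50 / 1) * ((+ 2500 / 1) * tQ - gQ) - ((+ 2500 / 1) * sqNorm V - s))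
        (Form-affine (+ 40 / 1) (+ 10 / 1) κ V V)
        (subst (λ s → 0ℚ ≤ (+ 50 / 1) * s - laplacian κ′ (+ 2500 / 1) V) (sum-laplacian κ′ (+ 2500 / 1) Q)
          (≤⇒diff-nonneg (laplacian-colSum κ′ (+ 2500 / 1) κ′-sym (affine-row (+ 40 / 1) (+ 10 / 1)) κ′-nonneg
            v (+ 50 / 1) |v|² Q (masked v vv))))

      gap-bound : 0ℚ ≤ ((Form κ U U + ((- (+ 1 / 5)) + (- (+ 1 / 5))) * Form κ U V)
                            + ((- (+ 1 / 5)) * (- (+ 1 / 5))) * Form κ V V)
                       - (+ 1 / 6) * ((a + (- (+ 1 / 5)) * b) * (a + (- (+ 1 / 5)) * b))
      gap-bound = ≤⇒diff-nonneg (begin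
        (+ 1 / 6) * ((a + (- (+ 1 / 5)) * b) * (a + (- (+ 1 / 5)) * b))
          ≡⟨ cong (λ s → (+ 1 / 6) * (s * s)) (sym (trans (sum-+ U (λ k → (- (+ 1 / 5)) * V k))
               (cong (λ s → a + s) (sum-*ˡ (- (+ 1 / 5)) V)))) ⟩
        (+ 1 / 6) * (sum w * sum w)
          ≤⟨ κ-centered w ⟩
        Form κ w w
          ≡⟨ Form-combination κ-sym (- (+ 1 / 5)) U V ⟩
        (Form κ U U + ((- (+ 1 / 5)) + (- (+ 1 / 5))) * Form κ U V) + ((- (+ 1 / 5)) * (- (+ 1 / 5))) * Form κ V V ∎)
        where open ℚ.≤-Reasoning

    y-form≥0 : 0ℚ ≤ ∑⁴ (λ i k j l → x i k * y i k j l * x j l)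
    y-form≥0 = ℚ.*-cancelˡ-≤-pos (+ 60 / 1) (subst (0ℚ ≤_) (sym squares)
      (+-nonneg (+-nonneg (*-nonneg (ℚ.nonNegative⁻¹ (+ 1 / 90)) P-bound)
                          (*-nonneg (ℚ.nonNegative⁻¹ (+ 1 / 122500)) Q-bound))
                (+-nonneg (*-nonneg (ℚ.nonNegative⁻¹ (+ 1 / 10)) gap-bound)
                          (*-nonneg (ℚ.nonNegative⁻¹ (+ 1 / 60)) (square-nonneg (a + b))))))

  -- The matrix and its constraints

  Y : Matrix (n ℕ.* n) (n ℕ.* n)
  Y a b = fromℚ (y (quotient n a) (remainder {n} n a) (quotient n b) (remainder {n} n b))

  seq-trace : (A : Matrix (n ℕ.* n) (n ℕ.* n)) (f : Fin n → Fin n → Fin n → Fin n → ℚ) (N : ℕ) →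
              (∀ a b → seq (A a b) N ≡ f (quotient n a) (remainder {n} n a) (quotient n b) (remainder {n} n b)) →
              seq (trace (A ⊡ Y)) N ≡ ∑⁴ (λ i k j l → f i k j l * y i k j l)
  seq-trace A f N A≡f = seq-∑⁴ {n} (λ a b → A a b *ʳ Y b a) (λ i k j l → f i k j l * y i k j l) N
    λ a b → cong₂ _*_ (A≡f a b)
      (y-sym (quotient n b) (remainder {n} n b) (quotient n a) (remainder {n} n a))

  Y-psd : PSD Y
  Y-psd = record
    { symmetric = λ a b → ≈-pointwise λ _ →
        y-sym (quotient n a) (remainder {n} n a) (quotient n b) (remainder {n} n b)
    -- The entries of `Y` are constant sequences and those of x are rational at each index N, so the
    -- rational inequality applies exactly at every N, without an error term.
    ; form≥0 = λ x → ≤-pointwise λ N →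
        let X : Fin n → Fin n → ℚ
            X i k = seq (x (combine i k)) N
            seq-x : ∀ a → seq (x a) N ≡ X (quotient n a) (remainder {n} n a)
            seq-x a = cong (λ c → seq (x c) N) (sym (combine-remQuot {n} n a))
        in subst (0ℚ ≤_)
             (sym (seq-∑⁴ {n} (λ a b → x a *ʳ Y a b *ʳ x b) (λ i k j l → X i k * y i k j l * X j l) N
               λ a b → cong₂ (λ s t → s * seq (Y a b) N * t) (seq-x a) (seq-x b)))
             (y-form≥0 X)
    }

  cond₁-trace : ∀ c → ∑⁴ (λ i k j l → (δ i j * (δ k c * δ l c)) * y i k j l) ≡ 1ℚ
  cond₁-trace c = begin
    ∑⁴ (λ i k j l → (δ i j * (δ k c * δ l c)) * y i k j l)
      ≡⟨ ∑⁴-cong (λ i k j l → solve 4 (λ a b c z → (a :* (b :* c)) :* z := a :* (c :* (b :* z)))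
           refl (δ i j) (δ k c) (δ l c) (y i k j l)) ⟩
    ∑⁴ (λ i k j l → δ i j * (δ l c * (δ k c * y i k j l)))
      ≡⟨ ∑⁴-δˡ (λ i k j l → δ l c * (δ k c * y i k j l)) ⟩
    ∑∑ (λ i k → sum λ l → δ l c * (δ k c * y i k i l))
      ≡⟨ ∑∑-cong (λ i k → sum-δʳ c (λ l → δ k c * y i k i l)) ⟩
    ∑∑ (λ i k → δ k c * y i k i c)
      ≡⟨ sum-cong (λ i → trans (sum-δʳ c (λ k → y i k i c)) (y-diag i c)) ⟩
    sum {n} (const (+ 1 / 60))
      ≡⟨ sum-ones (+ 1 / 60) ⟩
    1ℚ ∎
    where open ≡-Reasoning

  cond₂-trace : ∀ c → ∑⁴ (λ i k j l → ((δ i c * δ j c) * δ k l) * y i k j l) ≡ 1ℚ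
  cond₂-trace c = begin
    ∑⁴ (λ i k j l → ((δ i c * δ j c) * δ k l) * y i k j l)
      ≡⟨ ∑⁴-cong (λ i k j l → solve 4 (λ a b c z → ((a :* b) :* c) :* z := c :* (b :* (a :* z)))
           refl (δ i c) (δ j c) (δ k l) (y i k j l)) ⟩
    ∑⁴ (λ i k j l → δ k l * (δ j c * (δ i c * y i k j l)))
      ≡⟨ ∑⁴-δʳ (λ i k j l → δ j c * (δ i c * y i k j l)) ⟩
    ∑∑ (λ i k → sum λ j → δ j c * (δ i c * y i k j k))
      ≡⟨ ∑∑-cong (λ i k → sum-δʳ c (λ j → δ i c * y i k j k)) ⟩
    ∑∑ (λ i k → δ i c * y i k c k)
      ≡⟨ ∑∑-comm (λ i k → δ i c * y i k c k) ⟩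
    ∑∑ (λ k i → δ i c * y i k c k)
      ≡⟨ sum-cong (λ k → trans (sum-δʳ c (λ i → y i k c k)) (y-diag c k)) ⟩
    sum {n} (const (+ 1 / 60))
      ≡⟨ sum-ones (+ 1 / 60) ⟩
    1ℚ ∎
    where open ≡-Reasoning

  cond₃-trace : ∑⁴ (λ i k j l → (δ i j * (1ℚ - δ k l) + (1ℚ - δ i j) * δ k l) * y i k j l) ≡ 0ℚ
  cond₃-trace = trans
    (∑⁴-cong λ i k j l → trans
      (ℚ.*-distribʳ-+ (y i k j l) (δ i j * (1ℚ - δ k l)) ((1ℚ - δ i j) * δ k l))
      (cong₂ _+_ (y-same-city i k j l) (y-same-position i k j l)))
    (trans (sum-cong λ _ → trans (sum-cong λ _ → trans (sum-cong λ _ → sum-zero n) (sum-zero n)) (sum-zero n))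
      (sum-zero n))

  ∑∑-offDiagonal : (f : Fin n → Fin n → ℚ) →
                   ∑∑ (λ i j → (1ℚ - δ i j) * f i j) ≡ ∑∑ f - sum (λ i → f i i)
  ∑∑-offDiagonal f = trans
    (∑∑-cong λ i j → solve 2 (λ a z → (con 1ℚ :- a) :* z := z :+ con (- 1ℚ) :* (a :* z)) refl (δ i j) (f i j))
    (trans (∑∑-+ f (λ i j → (- 1ℚ) * (δ i j * f i j)))
      (trans (cong (λ s → ∑∑ f + s) (trans (∑∑-*ˡ (- 1ℚ) (λ i j → δ i j * f i j))
               (cong ((- 1ℚ) *_) (sum-cong λ i → sum-δ i (f i)))))
        (solve 2 (λ a b → a :+ con (- 1ℚ) :* b := a :- b) refl (∑∑ f) (sum λ i → f i i))))

  ∑∑-mixed : ∑∑ mixed ≡ + 1000 / 1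
  ∑∑-mixed = trans (∑∑-+ (λ i j → u i * v j) (λ i j → v i * u j))
    (cong₂ _+_ (trans (∑∑-product u v) (cong₂ _*_ sum-u sum-v)) (trans (∑∑-product v u) (cong₂ _*_ sum-v sum-u)))

  -- Each summand of the weight is a function of the cities times a function of the positions, so
  -- every fourfold sum factors. The mass splits as 60 + 90 + 2450 + 1000, the numbers of ordered
  -- pairs of cities that are equal, both in the small part, both in the large part, and separated:
  -- each pair of cities carries mass one.
  cond₄-trace : ∑⁴ (λ i k j l → (1ℚ * 1ℚ) * y i k j l) ≡ + 3600 / 1
  cond₄-trace = begin
    ∑⁴ (λ i k j l → (1ℚ * 1ℚ) * y i k j l)
      ≡⟨ ∑⁴-cong (λ i k j l → trans (ℚ.*-comm (1ℚ * 1ℚ) (y i k j l))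
           (trans (weight-expand (δ i j) (δ k l) (κ k l) (u i * u j) (v i * v j) (mixed i j) (1ℚ * 1ℚ))
             (separate (δ i j) (δ k l) (κ k l) (κ′ k l) (κ̄ k l) (u i * u j) (v i * v j) (mixed i j)))) ⟩
    ∑⁴ (λ i k j l → (+ 1 / 60) * (g₁ i k j l + g₂ i k j l))
      ≡⟨ trans (∑⁴-*ˡ (+ 1 / 60) (λ i k j l → g₁ i k j l + g₂ i k j l)) (cong ((+ 1 / 60) *_)
           (trans (∑⁴-+ g₁ g₂) (cong₂ _+_
             (trans (∑⁴-+ (λ i k j l → δ i j * δ k l) g₃) (cong₂ _+_ (∑⁴-product δ δ)
               (trans (∑⁴-+ (λ i k j l → (+ 1 / 9) * (((1ℚ - δ i j) * (u i * u j)) * ((1ℚ - δ k l) * κ k l)))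
                            (λ i k j l → (+ 1 / 2450) * (((1ℚ - δ i j) * (v i * v j)) * ((1ℚ - δ k l) * κ′ k l))))
                 (cong₂ _+_
                   (trans (∑⁴-*ˡ (+ 1 / 9) (λ i k j l → ((1ℚ - δ i j) * (u i * u j)) * ((1ℚ - δ k l) * κ k l)))
                     (cong ((+ 1 / 9) *_)
                       (∑⁴-product (λ i j → (1ℚ - δ i j) * (u i * u j)) (λ k l → (1ℚ - δ k l) * κ k l))))
                   (trans (∑⁴-*ˡ (+ 1 / 2450) (λ i k j l → ((1ℚ - δ i j) * (v i * v j)) * ((1ℚ - δ k l) * κ′ k l)))
                     (cong ((+ 1 / 2450) *_)
                       (∑⁴-product (λ i j → (1ℚ - δ i j) * (v i * v j)) (λ k l → (1ℚ - δ k l) * κ′ k l))))))))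
             (trans (∑⁴-*ˡ (+ 1 / 50) (λ i k j l → mixed i j * κ̄ k l)) (cong ((+ 1 / 50) *_) (∑⁴-product mixed κ̄)))))) ⟩
    value (∑∑ {n} {n} δ) (∑∑ (λ i j → (1ℚ - δ i j) * (u i * u j))) (∑∑ (λ k l → (1ℚ - δ k l) * κ k l))
      (∑∑ (λ i j → (1ℚ - δ i j) * (v i * v j))) (∑∑ (λ k l → (1ℚ - δ k l) * κ′ k l)) (∑∑ mixed) (∑∑ κ̄)
      ≡⟨ value-cong ∑∑δ
           (offDiagonal-square u (+ 10 / 1) sum-u uu) (offDiagonal-kernel κ (+ 10 / 1) 1ℚ κ-row κ-diag)
           (offDiagonal-square v (+ 50 / 1) sum-v vv)
           (offDiagonal-kernel κ′ (+ 2500 / 1) (+ 50 / 1) (affine-row (+ 40 / 1) (+ 10 / 1)) κ′-diag)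
           ∑∑-mixed (trans (sum-cong (affine-row 1ℚ (- 1ℚ))) (sum-ones (+ 50 / 1))) ⟩
    + 3600 / 1 ∎
    where
    open ≡-Reasoning
    g₁ g₂ g₃ : Fin n → Fin n → Fin n → Fin n → ℚ
    g₃ i k j l = (+ 1 / 9) * (((1ℚ - δ i j) * (u i * u j)) * ((1ℚ - δ k l) * κ k l))
               + (+ 1 / 2450) * (((1ℚ - δ i j) * (v i * v j)) * ((1ℚ - δ k l) * κ′ k l))
    g₁ i k j l = δ i j * δ k l + g₃ i k j l
    g₂ i k j l = (+ 1 / 50) * (mixed i j * κ̄ k l)
    separate : ∀ a b q q′ q̄ U V m →
      (+ 1 / 60) * ((a * (b * (1ℚ * 1ℚ))
        + ((+ 1 / 9) * (((1ℚ - a) * (1ℚ - b)) * (q * (U * (1ℚ * 1ℚ))))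
         + (+ 1 / 2450) * (((1ℚ - a) * (1ℚ - b)) * (q′ * (V * (1ℚ * 1ℚ))))))
        + (+ 1 / 50) * (q̄ * (m * (1ℚ * 1ℚ))))
      ≡ (+ 1 / 60) * ((a * b
        + ((+ 1 / 9) * (((1ℚ - a) * U) * ((1ℚ - b) * q)) + (+ 1 / 2450) * (((1ℚ - a) * V) * ((1ℚ - b) * q′))))
        + (+ 1 / 50) * (m * q̄))
    separate = solve 8 (λ a b q q′ q̄ U V m →
      con (+ 1 / 60) :* ((a :* (b :* con 1ℚ)
        :+ (con (+ 1 / 9) :* (((con 1ℚ :- a) :* (con 1ℚ :- b)) :* (q :* (U :* con 1ℚ)))
         :+ con (+ 1 / 2450) :* (((con 1ℚ :- a) :* (con 1ℚ :- b)) :* (q′ :* (V :* con 1ℚ)))))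
        :+ con (+ 1 / 50) :* (q̄ :* (m :* con 1ℚ)))
      := con (+ 1 / 60) :* ((a :* b
        :+ (con (+ 1 / 9) :* (((con 1ℚ :- a) :* U) :* ((con 1ℚ :- b) :* q))
          :+ con (+ 1 / 2450) :* (((con 1ℚ :- a) :* V) :* ((con 1ℚ :- b) :* q′))))
        :+ con (+ 1 / 50) :* (m :* q̄))) refl
    value : (d p s q t m r : ℚ) → ℚ
    value d p s q t m r = (+ 1 / 60) * ((d * d + ((+ 1 / 9) * (p * s) + (+ 1 / 2450) * (q * t))) + (+ 1 / 50) * (m * r))
    value-cong : ∀ {d p s q t m r} → d ≡ + 60 / 1 → p ≡ + 90 / 1 → s ≡ + 540 / 1 → q ≡ + 2450 / 1 →
                 t ≡ + 147000 / 1 → m ≡ + 1000 / 1 → r ≡ + 3000 / 1 → value d p s q t m r ≡ + 3600 / 1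
    value-cong refl refl refl refl refl refl refl = refl
    ∑∑δ : ∑∑ {n} {n} δ ≡ + 60 / 1
    ∑∑δ = trans (sum-cong λ i → trans (sum-cong λ j → sym (ℚ.*-identityʳ (δ i j))) (sum-δ i (const 1ℚ))) (sum-ones 1ℚ)
    offDiagonal-square : ∀ (f : Fin n → ℚ) q → sum f ≡ q → (∀ i → f i * f i ≡ f i) →
                         ∑∑ (λ i j → (1ℚ - δ i j) * (f i * f j)) ≡ q * q - q
    offDiagonal-square f q sum-f ff = trans (∑∑-offDiagonal λ i j → f i * f j)
      (cong₂ _-_ (trans (∑∑-product f f) (cong₂ _*_ sum-f sum-f)) (trans (sum-cong ff) sum-f))
    offDiagonal-kernel : ∀ (K : Fin n → Fin n → ℚ) R d → (∀ k → sum (K k) ≡ R) → (∀ k → K k k ≡ d) →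
                         ∑∑ (λ k l → (1ℚ - δ k l) * K k l) ≡ (+ 60 / 1) * R - (+ 60 / 1) * d
    offDiagonal-kernel K R d row diag = trans (∑∑-offDiagonal K)
      (cong₂ _-_ (trans (sum-cong row) (sum-ones R)) (trans (sum-cong diag) (sum-ones d)))

  Y-feasible : Feasible n Y
  Y-feasible = record
    { psd    = Y-psd
    ; nonneg = λ a b → ≤-pointwise λ _ →
        y-nonneg (quotient n a) (remainder {n} n a) (quotient n b) (remainder {n} n b)
    ; cond₁  = λ c → ≈-pointwise λ N → trans
        (seq-trace (I n ⊗ E n c) (λ i k j l → δ i j * (δ k c * δ l c)) N λ a b →
          cong₂ _*_ (seq-δ (quotient n a) (quotient n b) N)
            (cong₂ _*_ (seq-δ (remainder {n} n a) c N) (seq-δ (remainder {n} n b) c N)))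
        (cond₁-trace c)
    ; cond₂  = λ c → ≈-pointwise λ N → trans
        (seq-trace (E n c ⊗ I n) (λ i k j l → (δ i c * δ j c) * δ k l) N λ a b →
          cong₂ _*_ (cong₂ _*_ (seq-δ (quotient n a) c N) (seq-δ (quotient n b) c N))
            (seq-δ (remainder {n} n a) (remainder {n} n b) N))
        (cond₂-trace c)
    ; cond₃  = ≈-pointwise λ N → trans
        (seq-trace (I n ⊗ (J n ⊖ I n) ⊕ (J n ⊖ I n) ⊗ I n)
          (λ i k j l → δ i j * (1ℚ - δ k l) + (1ℚ - δ i j) * δ k l) N λ a b →
          cong₂ (λ s t → s * (1ℚ - t) + (1ℚ - s) * t) (seq-δ (quotient n a) (quotient n b) N)
            (seq-δ (remainder {n} n a) (remainder {n} n b) N))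
        cond₃-trace
    ; cond₄  = ≈-pointwise λ N → trans
        (seq-trace (J n ⊗ J n) (λ _ _ _ _ → 1ℚ * 1ℚ) N λ _ _ → refl)
        (trans cond₄-trace (cong (λ m → + (m ℕ.* m) / 1) (sym n≡60)))
    }
    where
    seq-δ : (i j : Fin n) → ∀ N → seq (I n i j) N ≡ δ i j
    seq-δ i j = seq-𝟙 ⌊ i ≟ j ⌋

  -- Cost of the relaxed solution

  module _ (r s : Fin (suc n)) (step : Fin n → Fin n)
    (deg-r : sum (λ k → indicator (adjacent (punchIn r k) r)) ≤ + 2 / 1)
    (adjacent-step : ∀ k l → indicator (adjacent (punchIn r k) (punchIn r l)) ≤ δ (step k) l + δ (step l) k)
    (κ-step : ∀ k → κ k (step k) ≡ + 31 / 32) where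

    private
      c : Fin n → Fin n → ℚ
      c k l = indicator (adjacent (punchIn r k) (punchIn r l))

      -- City s occupies position r and belongs to the large part, so an edge at r costs 1 exactly
      -- when the neighbouring position holds a city of the small part.
      e : Fin n → Fin n → ℚ
      e i k = indicator (adjacent (punchIn r k) r) * u i

      mixed-cases : ∀ i j → mixed i j ≡ 0ℚ ⊎ (mixed i j ≡ 1ℚ × δ i j ≡ 0ℚ × u i * u j ≡ 0ℚ × v i * v j ≡ 0ℚ)
      mixed-cases i j with δ-cases i j
      ... | inj₂ (refl , _) = inj₁ (mixed-diag i)
      ... | inj₁ δ≡0 with side i | side j
      ...   | true  | true  = inj₁ refl
      ...   | true  | false = inj₂ (refl , δ≡0 , refl , refl)
      ...   | false | true  = inj₂ (refl , δ≡0 , refl , refl)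
      ...   | false | false = inj₁ refl

      seq-xor : ∀ i j → indicator (side i xor side j) ≡ mixed i j
      seq-xor i j with side i | side j
      ... | true  | true  = refl
      ... | true  | false = refl
      ... | false | true  = refl
      ... | false | false = refl

      κ̄-step : ∀ k → κ̄ k (step k) ≡ + 1 / 32
      κ̄-step k = cong (λ q → 1ℚ + (- 1ℚ) * q) (κ-step k)

      sum-δ-κ̄ : ∑∑ (λ k l → δ (step k) l * κ̄ k l) ≡ + 60 / 32
      sum-δ-κ̄ = trans (sum-cong λ k → trans (sum-δ (step k) (κ̄ k)) (κ̄-step k)) (sum-ones (+ 1 / 32))

      -- All 60 steps are charged, each with 1 - 31/32 and in both orders of its ends.
      path-bound : ∑∑ (λ k l → c k l * κ̄ k l) ≤ + 120 / 32
      path-bound = begin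
        ∑∑ (λ k l → c k l * κ̄ k l)
          ≤⟨ ∑∑-mono (λ k l → ℚ.*-monoʳ-≤-nonNeg (κ̄ k l) {{nonNegative (κ̄-nonneg k l)}} (adjacent-step k l)) ⟩
        ∑∑ (λ k l → (δ (step k) l + δ (step l) k) * κ̄ k l)
          ≡⟨ ∑∑-cong (λ k l → trans (ℚ.*-distribʳ-+ (κ̄ k l) (δ (step k) l) (δ (step l) k))
               (cong (λ q → δ (step k) l * κ̄ k l + δ (step l) k * q) (κ̄-sym k l))) ⟩
        ∑∑ (λ k l → δ (step k) l * κ̄ k l + δ (step l) k * κ̄ l k)
          ≡⟨ trans (∑∑-+ (λ k l → δ (step k) l * κ̄ k l) (λ k l → δ (step l) k * κ̄ l k))
               (cong₂ _+_ sum-δ-κ̄ (trans (∑∑-comm λ k l → δ (step l) k * κ̄ l k) sum-δ-κ̄)) ⟩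
        + 120 / 32 ∎
        where open ℚ.≤-Reasoning

      f₁ f₂ : Fin n → Fin n → Fin n → Fin n → ℚ
      f₁ i k j l = mixed i j * (½ * c k l)
      f₂ i k j l = e i k * (δ i j * δ k l)

      -- Only separated cities are at positive distance, and there a single summand of the weight
      -- survives; the 1000 ordered pairs of such cities turn 1/6000 into 1/6.
      ∑f₁ : ∑⁴ (λ i k j l → f₁ i k j l * y i k j l) ≡ (+ 1 / 6) * ∑∑ (λ k l → c k l * κ̄ k l)
      ∑f₁ = begin
        ∑⁴ (λ i k j l → f₁ i k j l * y i k j l)
          ≡⟨ ∑⁴-cong (λ i k j l → begin
               mixed i j * (½ * c k l) * y i k j l
                 ≡⟨ solve 3 (λ m c w → m :* (con ½ :* c) :* w := (con ½ :* c) :* (m :* w)) refl (mixed i j) (c k l) (y i k j l) ⟩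
               (½ * c k l) * (mixed i j * y i k j l)
                 ≡⟨ cong ((½ * c k l) *_) (weight-mixed {δ i j} (δ k l) (κ k l) (mixed-cases i j)) ⟩
               (½ * c k l) * ((+ 1 / 3000) * (mixed i j * κ̄ k l))
                 ≡⟨ solve 3 (λ m c z → (con ½ :* c) :* (con (+ 1 / 3000) :* (m :* z)) := con (+ 1 / 6000) :* (m :* (c :* z)))
                      refl (mixed i j) (c k l) (κ̄ k l) ⟩
               (+ 1 / 6000) * (mixed i j * (c k l * κ̄ k l)) ∎) ⟩
        ∑⁴ (λ i k j l → (+ 1 / 6000) * (mixed i j * (c k l * κ̄ k l)))
          ≡⟨ trans (∑⁴-*ˡ (+ 1 / 6000) (λ i k j l → mixed i j * (c k l * κ̄ k l)))
               (cong ((+ 1 / 6000) *_) (trans (∑⁴-product mixed (λ k l → c k l * κ̄ k l))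
                 (cong (_* ∑∑ (λ k l → c k l * κ̄ k l)) ∑∑-mixed))) ⟩
        (+ 1 / 6000) * ((+ 1000 / 1) * ∑∑ (λ k l → c k l * κ̄ k l))
          ≡⟨ ℚ.*-assoc (+ 1 / 6000) (+ 1000 / 1) (∑∑ (λ k l → c k l * κ̄ k l)) ⟨
        (+ 1 / 6) * ∑∑ (λ k l → c k l * κ̄ k l) ∎
        where open ≡-Reasoning

      ∑f₂ : ∑⁴ (λ i k j l → f₂ i k j l * y i k j l)
              ≡ (+ 1 / 6) * sum (λ k → indicator (adjacent (punchIn r k) r))
      ∑f₂ = begin
        ∑⁴ (λ i k j l → f₂ i k j l * y i k j l)
          ≡⟨ ∑⁴-cong (λ i k j l → solve 4 (λ e a b w → e :* (a :* b) :* w := a :* (b :* (e :* w)))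
               refl (e i k) (δ i j) (δ k l) (y i k j l)) ⟩
        ∑⁴ (λ i k j l → δ i j * (δ k l * (e i k * y i k j l)))
          ≡⟨ ∑⁴-δδ (λ i k j l → e i k * y i k j l) ⟩
        ∑∑ (λ i k → e i k * y i k i k)
          ≡⟨ ∑∑-cong (λ i k → trans (cong (e i k *_) (y-diag i k))
               (solve 2 (λ a b → (a :* b) :* con (+ 1 / 60) := con (+ 1 / 60) :* (b :* a)) refl
                 (indicator (adjacent (punchIn r k) r)) (u i))) ⟩
        ∑∑ (λ i k → (+ 1 / 60) * (u i * indicator (adjacent (punchIn r k) r)))
          ≡⟨ trans (∑∑-*ˡ (+ 1 / 60) (λ i k → u i * indicator (adjacent (punchIn r k) r)))
               (cong ((+ 1 / 60) *_) (trans (∑∑-product u (λ k → indicator (adjacent (punchIn r k) r)))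
                 (cong (_* sum (λ k → indicator (adjacent (punchIn r k) r))) sum-u))) ⟩
        (+ 1 / 60) * ((+ 10 / 1) * sum (λ k → indicator (adjacent (punchIn r k) r)))
          ≡⟨ ℚ.*-assoc (+ 1 / 60) (+ 10 / 1) (sum (λ k → indicator (adjacent (punchIn r k) r))) ⟨
        (+ 1 / 6) * sum (λ k → indicator (adjacent (punchIn r k) r)) ∎
        where open ≡-Reasoning

      g : Fin (suc n) → Bool
      g = extend s side

    seq-cost : ∀ N → seq (SDP₂-cost r s (cutMetric g) Y) N ≡ ∑⁴ (λ i k j l → (f₁ i k j l + f₂ i k j l) * y i k j l)
    seq-cost N = seq-trace
        (((cutMetric g [ punchIn s , punchIn s ]) ⊗ (½ℝ · (C₁ n [ punchIn r , punchIn r ])))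
          ⊕ Diag (c̄ r s (cutMetric g)))
        (λ i k j l → f₁ i k j l + f₂ i k j l) N λ a b → cong₂ _+_
      (cong₂ _*_ (distance (quotient {n} n a) (quotient {n} n b))
        (cong (½ *_) (seq-𝟙 (adjacent (punchIn r (remainder {n} n a)) (punchIn r (remainder {n} n b))) N)))
      (cong₂ _*_
        (trans (ℚ.+-identityʳ _)
          (cong₂ _*_ (seq-𝟙 (adjacent (punchIn r (remainder {n} n a)) r) N) (from-s (quotient {n} n a))))
        (trans (seq-𝟙 ⌊ a ≟ b ⌋ N) (δ-pairs {n} {n} a b)))
      where
      distance : ∀ i j → seq (cutMetric g (punchIn s i) (punchIn s j)) N ≡ mixed i j
      distance i j = trans (seq-𝟙 (g (punchIn s i) xor g (punchIn s j)) N)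
        (trans (cong₂ (λ x z → indicator (x xor z)) (extend-punchIn s side i) (extend-punchIn s side j)) (seq-xor i j))
      from-s : ∀ i → seq (cutMetric g s (punchIn s i)) N ≡ u i
      from-s i = trans (seq-𝟙 (g s xor g (punchIn s i)) N)
        (cong₂ (λ x z → indicator (x xor z)) (extend-self s side) (extend-punchIn s side i))

    Y-cost<1 : SDP₂-cost r s (cutMetric g) Y <ʳ 1ℝ
    Y-cost<1 = mk< (+ 1 / 24) (ℚ.positive⁻¹ (+ 1 / 24)) (0 , λ N _ → begin
      seq (SDP₂-cost r s (cutMetric g) Y) N + + 1 / 24
        ≡⟨ cong (λ q → q + + 1 / 24) (trans (seq-cost N)
             (trans (∑⁴-cong λ i k j l → ℚ.*-distribʳ-+ (y i k j l) (f₁ i k j l) (f₂ i k j l))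
               (trans (∑⁴-+ (λ i k j l → f₁ i k j l * y i k j l) (λ i k j l → f₂ i k j l * y i k j l))
                 (cong₂ _+_ ∑f₁ ∑f₂)))) ⟩
      ((+ 1 / 6) * ∑∑ (λ k l → c k l * κ̄ k l) + (+ 1 / 6) * sum (λ k → indicator (adjacent (punchIn r k) r))) + + 1 / 24
        ≤⟨ ℚ.+-monoˡ-≤ (+ 1 / 24) (ℚ.+-mono-≤
             (ℚ.*-monoˡ-≤-nonNeg (+ 1 / 6) path-bound) (ℚ.*-monoˡ-≤-nonNeg (+ 1 / 6) deg-r)) ⟩
      1ℚ ∎)
      where open ℚ.≤-Reasoning

  gap≥2 : (r s : ∀ n → Fin (suc n)) (step : Fin n → Fin n) →
    sum (λ k → indicator (adjacent (punchIn (r n) k) (r n))) ≤ + 2 / 1 →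
    (∀ k l → indicator (adjacent (punchIn (r n) k) (punchIn (r n) l)) ≤ δ (step k) l + δ (step l) k) →
    (∀ k → κ k (step k) ≡ + 31 / 32) →
    ∀ i → side i ≡ true → 2ℝ ≤ᴸ integralityGap r s
  gap≥2 r s step deg-r adjacent-step κ-step i side-i c c<2 = P , 1ℝ ,
    ((Y , Y-feasible) , Y-cost<1 (r n) (s n) step deg-r adjacent-step κ-step) ,
    (2ℝ , ≤-<-trans (≤-pointwise λ N → ℚ.≤-reflexive (ℚ.*-identityʳ (seq c N))) c<2 , tour≥2)
    where
    g : Fin (suc n) → Bool
    g = extend (s n) side
    tour≥2 : ∀ σ → 2ℝ ≤ʳ tourCost (cutMetric g) σ
    tour≥2 = tourCost≥2 g (punchIn (s n) i) (s n) (trans (extend-punchIn (s n) side i) side-i) (extend-self (s n) side)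
    P : Instance
    P = record
      { n          = n
      ; N≥3        = subst (λ m → 3 ℕ.≤ suc m) (sym n≡60) (ℕ.s≤s (ℕ.s≤s (ℕ.s≤s ℕ.z≤n)))
      ; D          = cutMetric g
      ; isInstance = cutMetric-isTSPInstance g
      ; OPT>0      = 2ℝ , mk< (+ 2 / 1) (ℚ.positive⁻¹ (+ 2 / 1)) (0 , λ _ _ → ℚ.≤-refl) , tour≥2
      }

-- The translates of a bump

sumℕ : ∀ {n} → (Fin n → ℕ) → ℕ
sumℕ = Vector.foldr ℕ._+_ 0

sum-⋆ : ∀ {n} (f : Fin n → ℕ) → sum (λ i → f i ⋆ 1ℚ) ≡ sumℕ f ⋆ 1ℚ
sum-⋆ {zero}  f = sum-empty (λ i → f i ⋆ 1ℚ)
sum-⋆ {suc n} f = trans (sum-suc (λ i → f i ⋆ 1ℚ))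
  (trans (cong (λ q → f zero ⋆ 1ℚ + q) (sum-⋆ (f ∘ suc))) (sym (×-homo-+ 1ℚ (f zero) (sumℕ (f ∘ suc)))))

count : ∀ {n} → (Fin n → Bool) → ℕ
count p = sumℕ λ i → if p i then 1 else 0

sum-indicator : ∀ {n} (p : Fin n → Bool) → sum (indicator ∘ p) ≡ count p ⋆ 1ℚ
sum-indicator p = trans (sum-cong λ i → indicator-⋆ (p i)) (sum-⋆ λ i → if p i then 1 else 0)
  where
  indicator-⋆ : ∀ b → indicator b ≡ (if b then 1 else 0) ⋆ 1ℚ
  indicator-⋆ true  = refl
  indicator-⋆ false = refl

⋆1-nonneg : ∀ m → 0ℚ ≤ m ⋆ 1ℚ
⋆1-nonneg zero    = ℚ.≤-refl
⋆1-nonneg (suc m) = +-nonneg (ℚ.nonNegative⁻¹ 1ℚ) (⋆1-nonneg m)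

module Gram (n : ℕ) (n≡60 : n ≡ 60) (h : Fin n → Fin n → ℕ)
  (h-norm : ∀ k → sumℕ (λ t → h k t ℕ.* h k t) ≡ 160)
  (h-row : ∀ k → sumℕ (h k) ≡ 40) (h-col : ∀ t → sumℕ (flip h t) ≡ 40) where

  φ : Fin n → Fin n → ℚ
  φ k t = h k t ⋆ 1ℚ

  gram : Fin n → Fin n → ℚ
  gram k l = (+ 1 / 160) * sum (λ t → φ k t * φ l t)

  gram-ℕ : ∀ k l → gram k l ≡ (+ 1 / 160) * (sumℕ (λ t → h k t ℕ.* h l t) ⋆ 1ℚ)
  gram-ℕ k l = cong ((+ 1 / 160) *_)
    (trans (sum-cong λ t → sym (×1-homo-* (h k t) (h l t))) (sum-⋆ λ t → h k t ℕ.* h l t))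

  gram-diag : ∀ k → gram k k ≡ 1ℚ
  gram-diag k = trans (gram-ℕ k k) (cong (λ m → (+ 1 / 160) * (m ⋆ 1ℚ)) (h-norm k))

  φ-norm : ∀ k → sum (λ t → φ k t * φ k t) ≡ + 160 / 1
  φ-norm k = trans (sum-cong λ t → sym (×1-homo-* (h k t) (h k t)))
    (trans (sum-⋆ λ t → h k t ℕ.* h k t) (cong (_⋆ 1ℚ) (h-norm k)))

  φ-row : ∀ k → sum (φ k) ≡ + 40 / 1
  φ-row k = trans (sum-⋆ (h k)) (cong (_⋆ 1ℚ) (h-row k))

  φ-col : ∀ t → sum (flip φ t) ≡ + 40 / 1
  φ-col t = trans (sum-⋆ (flip h t)) (cong (_⋆ 1ℚ) (h-col t))

  gram-sym : ∀ k l → gram k l ≡ gram l k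
  gram-sym k l = cong ((+ 1 / 160) *_) (sum-cong λ t → ℚ.*-comm (φ k t) (φ l t))

  gram-nonneg : ∀ k l → 0ℚ ≤ gram k l
  gram-nonneg k l = *-nonneg (ℚ.nonNegative⁻¹ (+ 1 / 160))
    (sum-nonneg λ t → *-nonneg (⋆1-nonneg (h k t)) (⋆1-nonneg (h l t)))

  gram-≤1 : ∀ k l → gram k l ≤ 1ℚ
  gram-≤1 k l = ℚ.*-monoˡ-≤-nonNeg (+ 1 / 160) (begin
    sum (λ t → φ k t * φ l t)
      ≤⟨ sum-mono (λ t → amgm (φ k t) (φ l t)) ⟩
    sum (λ t → ½ * (φ k t * φ k t + φ l t * φ l t))
      ≡⟨ trans (sum-*ˡ ½ (λ t → φ k t * φ k t + φ l t * φ l t))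
           (cong (½ *_) (trans (sum-+ (λ t → φ k t * φ k t) (λ t → φ l t * φ l t))
             (cong₂ _+_ (φ-norm k) (φ-norm l)))) ⟩
    + 160 / 1 ∎)
    where
    open ℚ.≤-Reasoning
    amgm : ∀ p q → p * q ≤ ½ * (p * p + q * q)
    amgm p q = diff-nonneg⇒≤ (subst (0ℚ ≤_)
      (solve 2 (λ p q → con ½ :* ((p :- q) :* (p :- q)) := con ½ :* (p :* p :+ q :* q) :- p :* q) refl p q)
      (*-nonneg (ℚ.nonNegative⁻¹ ½) (square-nonneg (p - q))))

  gram-row : ∀ k → sum (gram k) ≡ + 10 / 1
  gram-row k = begin
    sum (gram k)
      ≡⟨ sum-*ˡ (+ 1 / 160) (λ l → sum (λ t → φ k t * φ l t)) ⟩
    (+ 1 / 160) * ∑∑ (λ l t → φ k t * φ l t)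
      ≡⟨ cong ((+ 1 / 160) *_) (∑∑-comm λ l t → φ k t * φ l t) ⟩
    (+ 1 / 160) * ∑∑ (λ t l → φ k t * φ l t)
      ≡⟨ cong ((+ 1 / 160) *_) (trans
           (sum-cong λ t → trans (sum-*ˡ (φ k t) (flip φ t)) (cong (φ k t *_) (φ-col t)))
           (trans (sum-*ʳ (+ 40 / 1) (φ k)) (cong (_* (+ 40 / 1)) (φ-row k)))) ⟩
    + 10 / 1 ∎
    where open ≡-Reasoning

  module _ (w : Fin n → ℚ) where

    private
      z : Fin n → ℚ
      z t = sum λ k → φ k t * w k

    Form-gram : Form gram w w ≡ (+ 1 / 160) * sqNorm z
    Form-gram = begin
      Form gram w w
        ≡⟨ ∑∑-cong (λ k l → ℚ.*-assoc (+ 1 / 160) (sum λ t → φ k t * φ l t) (w k * w l)) ⟩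
      ∑∑ (λ k l → (+ 1 / 160) * (sum (λ t → φ k t * φ l t) * (w k * w l)))
        ≡⟨ ∑∑-*ˡ (+ 1 / 160) (λ k l → sum (λ t → φ k t * φ l t) * (w k * w l)) ⟩
      (+ 1 / 160) * ∑∑ (λ k l → sum (λ t → φ k t * φ l t) * (w k * w l))
        ≡⟨ cong ((+ 1 / 160) *_) (∑∑-cong λ k l → trans
             (sym (sum-*ʳ (w k * w l) (λ t → φ k t * φ l t)))
             (sum-cong λ t → solve 4 (λ a b c d → (a :* b) :* (c :* d) := (a :* c) :* (b :* d))
               refl (φ k t) (φ l t) (w k) (w l))) ⟩
      (+ 1 / 160) * ∑∑ (λ k l → sum λ t → (φ k t * w k) * (φ l t * w l))
        ≡⟨ cong ((+ 1 / 160) *_) (trans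
             (sum-cong λ k → ∑∑-comm λ l t → (φ k t * w k) * (φ l t * w l))
             (∑∑-comm λ k t → sum λ l → (φ k t * w k) * (φ l t * w l))) ⟩
      (+ 1 / 160) * sum (λ t → ∑∑ λ k l → (φ k t * w k) * (φ l t * w l))
        ≡⟨ cong ((+ 1 / 160) *_) (sum-cong λ t → ∑∑-product (λ k → φ k t * w k) (λ k → φ k t * w k)) ⟩
      (+ 1 / 160) * sqNorm z ∎
      where open ≡-Reasoning

    sum-z : sum (λ t → 1ℚ * z t) ≡ (+ 40 / 1) * sum w
    sum-z = begin
      sum (λ t → 1ℚ * z t)
        ≡⟨ sum-cong (λ t → ℚ.*-identityˡ (z t)) ⟩
      ∑∑ (λ t k → φ k t * w k)
        ≡⟨ ∑∑-comm (λ t k → φ k t * w k) ⟩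
      ∑∑ (λ k t → φ k t * w k)
        ≡⟨ sum-cong (λ k → trans (sum-*ʳ (w k) (φ k)) (cong (_* w k) (φ-row k))) ⟩
      sum (λ k → (+ 40 / 1) * w k)
        ≡⟨ sum-*ˡ (+ 40 / 1) w ⟩
      (+ 40 / 1) * sum w ∎
      where open ≡-Reasoning

    gram-centered : (+ 1 / 6) * (sum w * sum w) ≤ Form gram w w
    gram-centered = begin
      (+ 1 / 6) * (sum w * sum w)
        ≡⟨ solve 1 (λ q → con (+ 1 / 6) :* (q :* q)
             := con (+ 1 / 9600) :* ((con (+ 40 / 1) :* q) :* (con (+ 40 / 1) :* q))) refl (sum w) ⟩
      (+ 1 / 9600) * (((+ 40 / 1) * sum w) * ((+ 40 / 1) * sum w))
        ≡⟨ cong (λ q → (+ 1 / 9600) * (q * q)) sum-z ⟨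
      (+ 1 / 9600) * (sum (λ t → 1ℚ * z t) * sum (λ t → 1ℚ * z t))
        ≤⟨ ℚ.*-monoˡ-≤-nonNeg (+ 1 / 9600) (cauchySchwarz (const 1ℚ) z) ⟩
      (+ 1 / 9600) * (sum {n} (const (1ℚ * 1ℚ)) * sqNorm z)
        ≡⟨ cong (λ q → (+ 1 / 9600) * (q * sqNorm z))
             (trans (sum-const n (1ℚ * 1ℚ)) (cong (λ m → (m ⋆ 1ℚ) * (1ℚ * 1ℚ)) n≡60)) ⟩
      (+ 1 / 9600) * ((+ 60 / 1) * sqNorm z)
        ≡⟨ ℚ.*-assoc (+ 1 / 9600) (+ 60 / 1) (sqNorm z) ⟨
      (+ 1 / 160) * sqNorm z
        ≡⟨ Form-gram ⟨
      Form gram w w ∎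
      where open ℚ.≤-Reasoning

  kernel : Kernel n
  kernel = record
    { κ          = gram
    ; κ-sym      = gram-sym
    ; κ-nonneg   = gram-nonneg
    ; κ-≤1       = gram-≤1
    ; κ-diag     = gram-diag
    ; κ-row      = gram-row
    ; κ-centered = gram-centered
    }

adjacent-punchIn : ∀ {n} (r : Fin (suc (suc n))) →
  (∀ k → next (punchIn r k) ≡ r ⊎ next (punchIn r k) ≡ punchIn r (next k)) →
  ∀ k l → indicator (adjacent (punchIn r k) (punchIn r l)) ≤ δ (next k) l + δ (next l) k
adjacent-punchIn r skip k l = bound (punchIn r l ≟ next (punchIn r k)) (punchIn r k ≟ next (punchIn r l))
  where
  skipped : ∀ k l → punchIn r l ≡ next (punchIn r k) → next k ≡ l
  skipped k l l≡k⁺ with skip k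
  ... | inj₁ k⁺≡r = contradiction (trans l≡k⁺ k⁺≡r) (punchInᵢ≢i r l)
  ... | inj₂ k⁺≡  = sym (punchIn-injective r l (next k) (trans l≡k⁺ k⁺≡))
  δ≥0 : ∀ {m} (i j : Fin m) → 0ℚ ≤ δ i j
  δ≥0 i j = indicator-nonneg ⌊ i ≟ j ⌋
  1≤δ : ∀ {m} {i j : Fin m} → i ≡ j → 1ℚ ≤ δ i j
  1≤δ {i = i} refl = ℚ.≤-reflexive (sym (δ-refl i))
  bound : (p : Dec (punchIn r l ≡ next (punchIn r k))) (q : Dec (punchIn r k ≡ next (punchIn r l))) →
          indicator (⌊ p ⌋ ∨ ⌊ q ⌋) ≤ δ (next k) l + δ (next l) k
  bound (yes p) _       = ℚ.+-mono-≤ (1≤δ (skipped k l p)) (δ≥0 (next l) k)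
  bound (no _)  (yes q) = ℚ.+-mono-≤ (δ≥0 (next k) l) (1≤δ (skipped l k q))
  bound (no _)  (no _)  = +-nonneg (δ≥0 (next k) l) (δ≥0 (next l) k)

-- The squared norm is 160 = 40² / 10 and the squared norm of the difference
-- to a unit shift is 10, so neighbouring positions have κ = 155 / 160.
profile : ℕ → ℕ
profile 0  = 1
profile 1  = 2
profile 2  = 3
profile 3  = 4
profile 4  = 5
profile 5  = 5
profile 6  = 5
profile 7  = 5
profile 8  = 4
profile 9  = 3
profile 10 = 2
profile 11 = 1
profile _  = 0

bump : Fin 60 → Fin 60 → ℕ
bump k t = profile ((toℕ t ℕ.+ (60 ℕ.∸ toℕ k)) % 60)

abstract
  bump-norm : ∀ k → sumℕ (λ t → bump k t ℕ.* bump k t) ≡ 160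
  bump-norm = toWitness {a? = all? λ k → sumℕ (λ t → bump k t ℕ.* bump k t) ℕ.≟ 160} _

  bump-shift : ∀ k → sumℕ (λ t → bump k t ℕ.* bump (next k) t) ≡ 155
  bump-shift = toWitness {a? = all? λ k → sumℕ (λ t → bump k t ℕ.* bump (next k) t) ℕ.≟ 155} _

  bump-row : ∀ k → sumℕ (bump k) ≡ 40
  bump-row = toWitness {a? = all? λ k → sumℕ (bump k) ℕ.≟ 40} _

  bump-col : ∀ t → sumℕ (flip bump t) ≡ 40
  bump-col = toWitness {a? = all? λ t → sumℕ (flip bump t) ℕ.≟ 40} _

  degree : ∀ r → count (λ (k : Fin 60) → adjacent (punchIn r k) r) ≡ 2
  degree = toWitness {a? = all? λ r → count (λ (k : Fin 60) → adjacent (punchIn r k) r) ℕ.≟ 2} _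

  next-punchIn : ∀ (r : Fin 61) (k : Fin 60) → next (punchIn r k) ≡ r ⊎ next (punchIn r k) ≡ punchIn r (next k)
  next-punchIn = toWitness {a? = all? λ r → all? λ k →
    (next (punchIn r k) ≟ r) ⊎-dec (next (punchIn r k) ≟ punchIn r (next {59} k))} _

firstTen : Fin 60 → Bool
firstTen i = toℕ i ℕ.<ᵇ 10

firstTen-count : sum (indicator ∘ firstTen) ≡ + 10 / 1
firstTen-count = sum-indicator firstTen

corollary3p10 : (r s : (n : ℕ) → Fin (suc n)) → 2ℝ ≤ᴸ integralityGap r s
corollary3p10 r s = Relaxation.gap≥2 60 refl firstTen firstTen-count Bump.kernel r s next
  (ℚ.≤-reflexive (trans (sum-indicator λ k → adjacent (punchIn (r 60) k) (r 60)) (cong (_⋆ 1ℚ) (degree (r 60)))))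
  (adjacent-punchIn (r 60) (next-punchIn (r 60)))
  (λ k → trans (Bump.gram-ℕ k (next k)) (cong (λ m → (+ 1 / 160) * (m ⋆ 1ℚ)) (bump-shift k)))
  zero refl
  where module Bump = Gram 60 refl bump bump-norm bump-row bump-col
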